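{- Nontrivial large sets of simple $t$-designs over finite fields exist for $t\ge 2$. That is, there exist a prime power $q$ and integers $n,k,t,\lambda,N$ with $2\le t<k<n$, $\lambda\ge 1$ and $N\ge 2$, together with $N$ pairwise disjoint $t\text{ - }(n,k,\lambda;q)$ designs $\mathcal{B}_1,\dots,\mathcal{B}_N$ in $\mathbb{F}_q^n$ whose union is the set of all $k$-dimensional subspaces of $\mathbb{F}_q^n$.
   Context: Let $\mathbb{F}_q$ be the finite field with $q$ elements and $V=\mathbb{F}_q^n$. A $k$-subspace is a $k$-dimensional linear subspace. A (simple) $t\text{ - }(n,k,\lambda;q)$ design is a set $\mathcal{B}$ (no repeated members) of $k$-subspaces of $V$ such that each $t$-subspace of $V$ is contained in exactly $\lambda$ members of $\mathcal{B}$. The set of all $k$-subspaces of $V$ is the trivial design. An $LS_q[N](t,k,n)$ large set is a set of $N$ pairwise disjoint $t\text{ - }(n,k,\lambda;q)$ designs (all with the same $\lambda$) whose union is the set of all $k$-subspaces of $V$; it is nontrivial if it does not consist of the trivial design alone, i.e. if $N\ge 2$. -}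

module Defs where

open import Algebra.Apartness.Bundles using (HeytingField; HeytingCommutativeRing)
open import Algebra.Bundles using (CommutativeRing; Ring)
import Algebra.Definitions.RawMonoid as RawMonoidDefinitions
open import Algebra.Module.Bundles using (LeftModule)
import Algebra.Module.Construct.TensorUnit as TensorUnit
open import Data.Fin.Base using (Fin)
open import Data.Nat.Base using (ℕ; _≤_; _^_)
open import Data.Nat.Primality using (Prime)
open import Data.Product.Base using (Σ-syntax; ∃-syntax; _×_; _,_; proj₁)
open import Data.Vec.Functional using (Vector)
open import Function.Bundles using (Inverse)
open import Level using (Level; 0ℓ; _⊔_; suc)
open import Relation.Binary.Bundles using (Setoid)
import Relation.Binary.Construct.On as On
open import Relation.Binary.PropositionalEquality.Core using (_≡_; _≢_)
import Relation.Binary.PropositionalEquality.Properties as ≡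
open import Relation.Unary using (Pred; _∈_; _⊆_; _⊥_; _∩_)
open import Relation.Unary.Relation.Binary.Equality using (≐-setoid)

private
  variable
    a ℓ p r ℓr m ℓm : Level

HasCardinality : Setoid a ℓ → ℕ → Set (a ⊔ ℓ)
HasCardinality S n = Inverse S (≡.setoid (Fin n))

Restrict : (S : Setoid a ℓ) → Pred (Setoid.Carrier S) p → Setoid (a ⊔ p) ℓ
Restrict S P = On.setoid {B = Σ[ x ∈ Setoid.Carrier S ] P x} S proj₁

IsPrimePower : ℕ → Set
IsPrimePower q = ∃[ p ] ∃[ m ] (Prime p × 1 ≤ m × q ≡ p ^ m)

-- A Heyting field of finite cardinality has decidable equality, and tightness
-- of its apartness then makes every nonzero element invertible; 0 ≉ 1 follows
-- from irreflexivity.  So these are exactly the finite fields.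

record FiniteField (q : ℕ) : Set₁ where
  field
    heytingField : HeytingField 0ℓ 0ℓ 0ℓ

  open HeytingCommutativeRing
    (HeytingField.heytingCommutativeRing heytingField) public
    using (commutativeRing)
  open CommutativeRing commutativeRing public
    using (ring; setoid)

  field
    cardinality : HasCardinality setoid q

power : {R : Ring r ℓr} → LeftModule R m ℓm → ℕ → LeftModule R m ℓm
power M n = record
  { Carrierᴹ = Vector Carrierᴹ n
  ; _≈ᴹ_ = λ u v → ∀ i → u i ≈ᴹ v i
  ; _+ᴹ_ = λ u v i → u i +ᴹ v i
  ; _*ₗ_ = λ c v i → c *ₗ v i
  ; 0ᴹ = λ _ → 0ᴹ
  ; -ᴹ_ = λ v i → -ᴹ v i
  ; isLeftModule = record
    { isLeftSemimodule = record
      { +ᴹ-isCommutativeMonoid = record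
        { isMonoid = record
          { isSemigroup = record
            { isMagma = record
              { isEquivalence = record
                { refl = λ _ → ≈ᴹ-refl
                ; sym = λ p i → ≈ᴹ-sym (p i)
                ; trans = λ p q i → ≈ᴹ-trans (p i) (q i)
                }
              ; ∙-cong = λ p q i → +ᴹ-cong (p i) (q i)
              }
            ; assoc = λ u v w i → +ᴹ-assoc (u i) (v i) (w i)
            }
          ; identity = (λ v i → +ᴹ-identityˡ (v i)) , (λ v i → +ᴹ-identityʳ (v i))
          }
        ; comm = λ u v i → +ᴹ-comm (u i) (v i)
        }
      ; isPreleftSemimodule = record
        { *ₗ-cong = λ p q i → *ₗ-cong p (q i)
        ; *ₗ-zeroˡ = λ v i → *ₗ-zeroˡ (v i)
        ; *ₗ-distribʳ = λ v c d i → *ₗ-distribʳ (v i) c d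
        ; *ₗ-identityˡ = λ v i → *ₗ-identityˡ (v i)
        ; *ₗ-assoc = λ c d v i → *ₗ-assoc c d (v i)
        ; *ₗ-zeroʳ = λ c i → *ₗ-zeroʳ c
        ; *ₗ-distribˡ = λ c u v i → *ₗ-distribˡ c (u i) (v i)
        }
      }
    ; -ᴹ‿cong = λ p i → -ᴹ‿cong (p i)
    ; -ᴹ‿inverse = (λ v i → -ᴹ‿inverseˡ (v i)) , (λ v i → -ᴹ‿inverseʳ (v i))
    }
  }
  where open LeftModule M

module Subspaces {R : Ring 0ℓ 0ℓ} (V : LeftModule R 0ℓ 0ℓ) where
  open Ring R using (Carrier; _≈_; 0#)
  open LeftModule V
  open RawMonoidDefinitions +ᴹ-rawMonoid using (sum)

  record Subspace : Set₁ where
    field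
      member    : Pred Carrierᴹ 0ℓ
      ∈-resp-≈ᴹ : ∀ {u v} → u ≈ᴹ v → u ∈ member → v ∈ member
      0ᴹ-closed : 0ᴹ ∈ member
      +ᴹ-closed : ∀ {u v} → u ∈ member → v ∈ member → u +ᴹ v ∈ member
      *ₗ-closed : ∀ c {v} → v ∈ member → c *ₗ v ∈ member

  open Subspace public using (member)

  linearCombination : ∀ {k} → Vector Carrier k → Vector Carrierᴹ k → Carrierᴹ
  linearCombination c b = sum (λ i → c i *ₗ b i)

  LinearlyIndependent : ∀ {k} → Pred (Vector Carrierᴹ k) 0ℓ
  LinearlyIndependent b = ∀ c → linearCombination c b ≈ᴹ 0ᴹ → ∀ i → c i ≈ 0#

  record IsBasis (U : Subspace) {k} (b : Vector Carrierᴹ k) : Set where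
    field
      contained   : ∀ i → b i ∈ member U
      independent : LinearlyIndependent b
      spanning    : ∀ {v} → v ∈ member U → ∃[ c ] (v ≈ᴹ linearCombination c b)

  HasDimension : ℕ → Pred Subspace 0ℓ
  HasDimension k U = Σ[ b ∈ Vector Carrierᴹ k ] IsBasis U b

  -- Two k-subspaces are equal when they have the same vectors; the basis
  -- witnessing the dimension is irrelevant.

  subspaces : ℕ → Setoid (suc 0ℓ) 0ℓ
  subspaces k = On.setoid {B = Σ[ U ∈ Subspace ] HasDimension k U}
    (≐-setoid Carrierᴹ 0ℓ) (λ U → member (proj₁ U))

  _-Subspace : ℕ → Set₁
  k -Subspace = Setoid.Carrier (subspaces k)

  _⊑_ : ∀ {t k} → t -Subspace → k -Subspace → Set
  (T , _) ⊑ (U , _) = member T ⊆ member U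

module Designs {q : ℕ} (F : FiniteField q) (n : ℕ) where
  open FiniteField F using (ring)
  open Subspaces (power (TensorUnit.leftModule {R = ring}) n) public

  record Design (t k λ′ : ℕ) : Set₁ where
    field
      blocks     : Pred (k -Subspace) 0ℓ
      respects   : ∀ {U W} → Setoid._≈_ (subspaces k) U W → U ∈ blocks → W ∈ blocks
      isBalanced : (T : t -Subspace) →
                   HasCardinality (Restrict (subspaces k) (blocks ∩ (T ⊑_))) λ′

  open Design public using (blocks)

  record LargeSet (N t k λ′ : ℕ) : Set₁ where
    field
      design   : Fin N → Design t k λ′
      disjoint : ∀ {i j} → i ≢ j → blocks (design i) ⊥ blocks (design j)
      covers   : (U : k -Subspace) → ∃[ i ] (U ∈ blocks (design i))

{-# OPTIONS --safe #-}

-- Identify F₂⁸ with the field K of 256 elements.  The determinants A of (v, v², v⁴) and C of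
-- (v, v⁴, v⁸), where v runs over a basis of a plane, are alternating and F₂-multilinear, so they
-- depend only on the plane.  Hence so does the colour A⁸⁵ μ(A⁷¹ C), for any map μ from K to the
-- cube roots of unity, and multiplication by x ≠ 0 multiplies the colour of a plane by x⁵⁹⁵, a
-- cube root of unity.  For a suitable μ each of the three colours occurs 21 times among the 63
-- planes above every line ⟨1, s⟩; by scaling this holds above every line, so that the colour
-- classes form a large set of three 2-(8,3,21;2) designs.

module Submission where

open import Defs
open import Algebra.Bundles using (CommutativeRing; CommutativeSemiring)
open import Algebra.Apartness.Bundles using (HeytingField)
import Algebra.Solver.Ring
open import Algebra.Solver.Ring.AlmostCommutativeRing using (fromCommutativeSemiring; _-Raw-AlmostCommutative⟶_)
open import Data.Bool.Base using (Bool; true; false; if_then_else_; _xor_; _∧_; _∨_)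
import Data.Bool.Properties as Bool
open import Data.Fin.Base using (Fin; zero; suc)
import Data.Fin.Properties as Fin
open import Data.List.Base as List using (List; []; _∷_; _++_; filter; length)
open import Data.List.Membership.Propositional using (_∈_)
open import Data.List.Membership.Propositional.Properties using (∈-map⁺; ∈-map⁻; ∈-++⁺ˡ; ∈-++⁺ʳ; ∈-filter⁺; ∈-filter⁻; ∈-lookup)
import Data.List.Properties as List
import Data.List.Relation.Unary.All as ListAll
import Data.List.Relation.Unary.All.Properties as ListAll
open import Data.List.Relation.Unary.AllPairs using ([]; _∷_)
open import Data.List.Relation.Unary.Any as Any using (here)
import Data.List.Relation.Unary.Any.Properties as Any
open import Data.List.Relation.Unary.Unique.Propositional using (Unique)
import Data.List.Relation.Unary.Unique.Propositional.Properties as Unique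
open import Data.Nat.Base as ℕ using (ℕ; zero; suc; _≤_; _<_)
open import Data.Nat.DivMod using (_/_; _mod_)
open import Data.Nat.Primality using (prime[2])
import Data.Nat.Properties as ℕ
open import Data.Product.Base using (Σ-syntax; ∃-syntax; _×_; _,_; proj₁; proj₂)
open import Data.Sum.Base as Sum using (_⊎_; inj₁; inj₂)
open import Data.Vec.Base as Vec using (Vec; []; _∷_; zipWith; replicate; foldl; tail; lookup; tabulate)
open import Data.Vec.Functional using (Vector)
open import Data.Vec.Properties as Vec using (zipWith-assoc; zipWith-comm; zipWith-identityˡ; zipWith-identityʳ; tabulate∘lookup; lookup∘tabulate; tabulate-cong)
open import Data.Vec.Relation.Unary.All using (All; []; _∷_)
open import Data.Vec.Relation.Unary.All.Properties using (tabulate⁺)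
open import Function.Base using (_∘_)
open import Function.Construct.Symmetry using (inverse)
open import Level using (0ℓ)
open import Relation.Binary.Bundles using (Setoid)
open import Relation.Binary.Definitions using (DecidableEquality)
open import Relation.Binary.PropositionalEquality
open import Relation.Nullary.Decidable using (Dec; does; yes; no; map′; from-yes; dec⇒maybe; _×-dec_; _⊎-dec_; _→-dec_; ¬?; decidable-stable)
open import Relation.Nullary.Negation using (¬_; contradiction)
open import Relation.Unary using (Decidable; _∩_; _⊆_)

-- The exponents are dictated by scaling. Multiplication by x multiplies A by x⁷ and C by x¹³, and
-- 71 is the only exponent e modulo 255 with 7e + 13 divisible by 255, so A⁷¹C is constant on orbits
-- under scaling and `μ` can be chosen freely. A is the product of the seven nonzero vectors of the
-- plane. It therefore never vanishes, and A⁸⁵, its norm to F₄, is a cube root of unity. Since x⁵⁹⁵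
-- = x⁸⁵, a primitive x permutes the three colours cyclically, so the three designs are images of
-- one another. The determinants depend only on the plane because a change of basis over F₂ can only
-- have determinant 1. What remains is a finite check that the type checker carries out: 127 lines
-- through 1, with 63 planes above each. This is why the field is concrete arithmetic on bit vectors
-- and why unfolding is controlled.

private
  variable
    n k : ℕ

-- Exhaustive search and addition on bit vectors.

Bits : ℕ → Set
Bits = Vec Bool

infix 4 _≟_
_≟_ : DecidableEquality (Bits n)
_≟_ = Vec.≡-dec Bool._≟_

∀? : {P : Bits n → Set} → Decidable P → Dec (∀ v → P v)
∀? {zero}  P? = map′ (λ { p [] → p }) (λ p → p []) (P? [])
∀? {suc n} P? = map′ (λ { (p , q) (false ∷ v) → p v ; (p , q) (true ∷ v) → q v })
  (λ p → p ∘ (false ∷_) , p ∘ (true ∷_))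
  (∀? (P? ∘ (false ∷_)) ×-dec ∀? (P? ∘ (true ∷_)))

-- The hypothesis mentions only the Boolean part of the decision, so checking it by `refl` does not
-- normalise the proofs that the decision carries.
∀-by-evaluation : {P : Bits n → Set} (P? : Decidable P) → does (∀? P?) ≡ true → ∀ v → P v
∀-by-evaluation P? eq with yes p ← ∀? P? = p

∃? : {P : Bits n → Set} → Decidable P → Dec (∃[ v ] P v)
∃? {zero}  P? = map′ ([] ,_) (λ { ([] , p) → p }) (P? [])
∃? {suc n} P? = map′
  (λ { (inj₁ (v , p)) → false ∷ v , p ; (inj₂ (v , p)) → true ∷ v , p })
  (λ { (false ∷ v , p) → inj₁ (v , p) ; (true ∷ v , p) → inj₂ (v , p) })
  (∃? (P? ∘ (false ∷_)) ⊎-dec ∃? (P? ∘ (true ∷_)))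

infixl 6 _+_
_+_ : Bits n → Bits n → Bits n
_+_ = zipWith _xor_

𝟎 : Bits n
𝟎 = replicate _ false

infixr 8 _·_
_·_ : Bool → Bits n → Bits n
true  · v = v
false · v = 𝟎

+-assoc : (x y z : Bits n) → (x + y) + z ≡ x + (y + z)
+-assoc = zipWith-assoc Bool.xor-assoc

+-comm : (x y : Bits n) → x + y ≡ y + x
+-comm = zipWith-comm Bool.xor-comm

+-identityˡ : (x : Bits n) → 𝟎 + x ≡ x
+-identityˡ = zipWith-identityˡ Bool.xor-identityˡ

+-identityʳ : (x : Bits n) → x + 𝟎 ≡ x
+-identityʳ = zipWith-identityʳ Bool.xor-identityʳ

+-self : (x : Bits n) → x + x ≡ 𝟎
+-self []       = refl
+-self (b ∷ bs) = cong₂ _∷_ (Bool.xor-same b) (+-self bs)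

x+[x+y]≡y : (x y : Bits n) → x + (x + y) ≡ y
x+[x+y]≡y x y = trans (sym (+-assoc x x y)) (trans (cong (_+ y) (+-self x)) (+-identityˡ y))

x+y≡𝟎⇒x≡y : (x y : Bits n) → x + y ≡ 𝟎 → x ≡ y
x+y≡𝟎⇒x≡y x y eq = trans (sym (+-identityʳ x)) (trans (cong (x +_) (sym eq)) (x+[x+y]≡y x y))

+-interchange : (x y z w : Bits n) → (x + y) + (z + w) ≡ (x + z) + (y + w)
+-interchange x y z w = begin
  (x + y) + (z + w)  ≡⟨ +-assoc x y (z + w) ⟩
  x + (y + (z + w))  ≡⟨ cong (x +_) (+-assoc y z w) ⟨
  x + ((y + z) + w)  ≡⟨ cong (λ v → x + (v + w)) (+-comm y z) ⟩
  x + ((z + y) + w)  ≡⟨ cong (x +_) (+-assoc z y w) ⟩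
  x + (z + (y + w))  ≡⟨ +-assoc x z (y + w) ⟨
  (x + z) + (y + w)  ∎
  where open ≡-Reasoning

xor-interchange : ∀ p q r s → (p xor q) xor (r xor s) ≡ (p xor r) xor (q xor s)
xor-interchange p q r s = cong Vec.head (+-interchange (p ∷ []) (q ∷ []) (r ∷ []) (s ∷ []))

·-+ˡ : (p q : Bool) (v : Bits n) → (p xor q) · v ≡ p · v + q · v
·-+ˡ true  true  v = sym (+-self v)
·-+ˡ true  false v = sym (+-identityʳ v)
·-+ˡ false q     v = sym (+-identityˡ (q · v))

·-+ʳ : (p : Bool) (v w : Bits n) → p · (v + w) ≡ p · v + p · w
·-+ʳ true  v w = refl
·-+ʳ false v w = sym (+-identityˡ 𝟎)

-- Arithmetic of the field `K`.

-- The field with 256 elements is F₂[x]/(x⁸ + x⁴ + x³ + x² + 1), in the basis 1, x, …, x⁷.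

K : Set
K = Bits 8

x· : K → K
x· (a ∷ b ∷ c ∷ d ∷ e ∷ f ∷ g ∷ h ∷ []) =
  h ∷ a ∷ (h xor b) ∷ (h xor c) ∷ (h xor d) ∷ e ∷ f ∷ g ∷ []

-- A polynomial in x with coefficients `bs`, lowest degree first, applied to `y`. The length is
-- arbitrary, although multiplication uses only length 8, so that the ring laws can be proved by
-- induction on the coefficients.
horner : Bits n → K → K
horner []           y = 𝟎
horner (false ∷ bs) y = x· (horner bs y)
horner (true  ∷ bs) y = y + x· (horner bs y)

infixl 7 _*_
_*_ : K → K → K
_*_ = horner

𝟏 : K
𝟏 = true ∷ 𝟎

horner-∷ : ∀ b (bs : Bits n) y → horner (b ∷ bs) y ≡ b · y + x· (horner bs y)
horner-∷ true  bs y = refl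
horner-∷ false bs y = sym (+-identityˡ _)

x·-+ : ∀ u v → x· (u + v) ≡ x· u + x· v
x·-+ (a ∷ b ∷ c ∷ d ∷ e ∷ f ∷ g ∷ h ∷ []) (a′ ∷ b′ ∷ c′ ∷ d′ ∷ e′ ∷ f′ ∷ g′ ∷ h′ ∷ [])
  rewrite xor-interchange h h′ b b′ | xor-interchange h h′ c c′ | xor-interchange h h′ d d′ = refl

x·-· : ∀ b y → x· (b · y) ≡ b · x· y
x·-· true  y = refl
x·-· false y = refl

horner-+ʳ : (bs : Bits n) (y z : K) → horner bs (y + z) ≡ horner bs y + horner bs z
horner-+ʳ []       y z = refl
horner-+ʳ (b ∷ bs) y z = begin
  horner (b ∷ bs) (y + z)
    ≡⟨ horner-∷ b bs (y + z) ⟩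
  b · (y + z) + x· (horner bs (y + z))
    ≡⟨ cong₂ _+_ (·-+ʳ b y z) (trans (cong x· (horner-+ʳ bs y z)) (x·-+ _ _)) ⟩
  (b · y + b · z) + (x· (horner bs y) + x· (horner bs z))
    ≡⟨ +-interchange (b · y) (b · z) _ _ ⟩
  (b · y + x· (horner bs y)) + (b · z + x· (horner bs z))
    ≡⟨ cong₂ _+_ (horner-∷ b bs y) (horner-∷ b bs z) ⟨
  horner (b ∷ bs) y + horner (b ∷ bs) z ∎
  where open ≡-Reasoning

horner-+ˡ : (as bs : Bits n) (y : K) → horner (as + bs) y ≡ horner as y + horner bs y
horner-+ˡ []       []       y = refl
horner-+ˡ (a ∷ as) (b ∷ bs) y = begin
  horner ((a ∷ as) + (b ∷ bs)) y
    ≡⟨ horner-∷ (a xor b) (as + bs) y ⟩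
  (a xor b) · y + x· (horner (as + bs) y)
    ≡⟨ cong₂ _+_ (·-+ˡ a b y) (trans (cong x· (horner-+ˡ as bs y)) (x·-+ _ _)) ⟩
  (a · y + b · y) + (x· (horner as y) + x· (horner bs y))
    ≡⟨ +-interchange (a · y) (b · y) _ _ ⟩
  (a · y + x· (horner as y)) + (b · y + x· (horner bs y))
    ≡⟨ cong₂ _+_ (horner-∷ a as y) (horner-∷ b bs y) ⟨
  horner (a ∷ as) y + horner (b ∷ bs) y ∎
  where open ≡-Reasoning

horner-zeroˡ : ∀ n y → horner (𝟎 {n}) y ≡ 𝟎
horner-zeroˡ zero    y = refl
horner-zeroˡ (suc n) y = cong x· (horner-zeroˡ n y)

horner-zeroʳ : (bs : Bits n) → horner bs 𝟎 ≡ 𝟎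
horner-zeroʳ []           = refl
horner-zeroʳ (true  ∷ bs) = cong (λ v → 𝟎 + x· v) (horner-zeroʳ bs)
horner-zeroʳ (false ∷ bs) = cong x· (horner-zeroʳ bs)

horner-x· : (bs : Bits n) (y : K) → horner bs (x· y) ≡ x· (horner bs y)
horner-x· []       y = refl
horner-x· (b ∷ bs) y = begin
  horner (b ∷ bs) (x· y)              ≡⟨ horner-∷ b bs (x· y) ⟩
  b · x· y + x· (horner bs (x· y))    ≡⟨ cong₂ _+_ (sym (x·-· b y)) (cong x· (horner-x· bs y)) ⟩
  x· (b · y) + x· (x· (horner bs y))  ≡⟨ x·-+ (b · y) _ ⟨
  x· (b · y + x· (horner bs y))       ≡⟨ cong x· (horner-∷ b bs y) ⟨
  x· (horner (b ∷ bs) y)              ∎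
  where open ≡-Reasoning

horner-∷ʳ : (bs : Bits n) (y : K) → horner (bs Vec.∷ʳ false) y ≡ horner bs y
horner-∷ʳ []           y = refl
horner-∷ʳ (true  ∷ bs) y = cong (λ v → y + x· v) (horner-∷ʳ bs y)
horner-∷ʳ (false ∷ bs) y = cong x· (horner-∷ʳ bs y)

x⁷ : K
x⁷ = false ∷ false ∷ false ∷ false ∷ false ∷ false ∷ false ∷ true ∷ []

-- Cayley-Hamilton for the linear map `x·`: its eighth power agrees with the reduction x⁴ + x³ + x²
-- + 1 of x⁸ applied to it.
x·x⁷-* : ∀ y → x· x⁷ * y ≡ x· (x⁷ * y)
x·x⁷-* = ∀-by-evaluation (λ y → x· x⁷ * y ≟ x· (x⁷ * y)) refl

x·-*-∷ʳ : ∀ (v : Bits 7) y → x· (v Vec.∷ʳ false) * y ≡ x· ((v Vec.∷ʳ false) * y)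
x·-*-∷ʳ (a ∷ b ∷ c ∷ d ∷ e ∷ f ∷ g ∷ []) y =
  cong x· (sym (horner-∷ʳ (a ∷ b ∷ c ∷ d ∷ e ∷ f ∷ g ∷ []) y))

-- Up to degree 6 the map `x·` only shifts coefficients. The coefficient of x⁷ is split off and
-- treated by `x·x⁷-*`.
x·-* : ∀ v y → x· v * y ≡ x· (v * y)
x·-* (a ∷ b ∷ c ∷ d ∷ e ∷ f ∷ g ∷ false ∷ []) y = x·-*-∷ʳ (a ∷ b ∷ c ∷ d ∷ e ∷ f ∷ g ∷ []) y
x·-* (a ∷ b ∷ c ∷ d ∷ e ∷ f ∷ g ∷ true  ∷ []) y = begin
  x· (x⁷ + v) * y            ≡⟨ cong (_* y) (x·-+ x⁷ v) ⟩
  (x· x⁷ + x· v) * y         ≡⟨ horner-+ˡ (x· x⁷) (x· v) y ⟩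
  x· x⁷ * y + x· v * y       ≡⟨ cong₂ _+_ (x·x⁷-* y) (x·-*-∷ʳ (a ∷ b ∷ c ∷ d ∷ e ∷ f ∷ g ∷ []) y) ⟩
  x· (x⁷ * y) + x· (v * y)   ≡⟨ x·-+ (x⁷ * y) (v * y) ⟨
  x· (x⁷ * y + v * y)        ≡⟨ cong x· (horner-+ˡ x⁷ v y) ⟨
  x· ((x⁷ + v) * y)          ∎
  where
  open ≡-Reasoning
  v = a ∷ b ∷ c ∷ d ∷ e ∷ f ∷ g ∷ false ∷ []

horner-* : (bs : Bits n) (y z : K) → horner bs y * z ≡ horner bs (y * z)
horner-* []       y z = horner-zeroˡ 8 z
horner-* (b ∷ bs) y z = begin
  horner (b ∷ bs) y * z                ≡⟨ cong (_* z) (horner-∷ b bs y) ⟩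
  (b · y + x· (horner bs y)) * z       ≡⟨ horner-+ˡ (b · y) _ z ⟩
  b · y * z + x· (horner bs y) * z     ≡⟨ cong₂ _+_ (·-* b) (trans (x·-* (horner bs y) z) (cong x· (horner-* bs y z))) ⟩
  b · (y * z) + x· (horner bs (y * z)) ≡⟨ horner-∷ b bs (y * z) ⟨
  horner (b ∷ bs) (y * z)              ∎
  where
  open ≡-Reasoning
  ·-* : ∀ b → (b · y) * z ≡ b · (y * z)
  ·-* true  = refl
  ·-* false = horner-zeroˡ 8 z

*-identityʳ : ∀ v → v * 𝟏 ≡ v
*-identityʳ = ∀-by-evaluation (λ v → v * 𝟏 ≟ v) refl

*-identityˡ : ∀ v → 𝟏 * v ≡ v
*-identityˡ v = trans (cong (λ u → v + x· u) (horner-zeroˡ 7 v)) (+-identityʳ v)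

-- Commutativity in disguise: every element is a polynomial in x applied to `𝟏`, and multiplication
-- by `y` commutes with `x·`.
*-horner : (bs : Bits n) (y : K) → y * horner bs 𝟏 ≡ horner bs y
*-horner []       y = horner-zeroʳ y
*-horner (b ∷ bs) y = begin
  y * horner (b ∷ bs) 𝟏                  ≡⟨ cong (y *_) (horner-∷ b bs 𝟏) ⟩
  y * (b · 𝟏 + x· (horner bs 𝟏))         ≡⟨ horner-+ʳ y (b · 𝟏) _ ⟩
  y * (b · 𝟏) + y * x· (horner bs 𝟏)     ≡⟨ cong₂ _+_ (*-· b) (trans (horner-x· y _) (cong x· (*-horner bs y))) ⟩
  b · y + x· (horner bs y)               ≡⟨ horner-∷ b bs y ⟨
  horner (b ∷ bs) y                      ∎
  where
  open ≡-Reasoning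
  *-· : ∀ b → y * (b · 𝟏) ≡ b · y
  *-· true  = *-identityʳ y
  *-· false = horner-zeroʳ y

*-comm : ∀ u v → u * v ≡ v * u
*-comm u v = trans (sym (*-horner u v)) (cong (v *_) (*-identityʳ u))

K-commutativeSemiring : CommutativeSemiring 0ℓ 0ℓ
K-commutativeSemiring = record
  { Carrier = K
  ; _≈_ = _≡_
  ; _+_ = _+_
  ; _*_ = _*_
  ; 0# = 𝟎
  ; 1# = 𝟏
  ; isCommutativeSemiring = record
    { isSemiring = record
      { isSemiringWithoutAnnihilatingZero = record
        { +-isCommutativeMonoid = record
          { isMonoid = record
            { isSemigroup = record
              { isMagma = isMagma _+_
              ; assoc = +-assoc
              }
            ; identity = +-identityˡ , +-identityʳ
            }
          ; comm = +-comm
          }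
        ; *-cong = cong₂ _*_
        ; *-assoc = horner-*
        ; *-identity = *-identityˡ , *-identityʳ
        ; distrib = horner-+ʳ , λ u v w → horner-+ˡ v w u
        }
      ; zero = horner-zeroˡ 8 , horner-zeroʳ
      }
    ; *-comm = *-comm
    }
  }

-- Coefficients in F₂ make the solver decide identities that need characteristic 2.

module Solver where
  morphism : CommutativeRing.rawRing Bool.xor-∧-commutativeRing
    -Raw-AlmostCommutative⟶ fromCommutativeSemiring K-commutativeSemiring
  morphism = record
    { ⟦_⟧    = _· 𝟏
    ; +-homo = λ p q → ·-+ˡ p q 𝟏
    ; *-homo = λ { true q → sym (*-identityˡ (q · 𝟏)) ; false q → sym (horner-zeroˡ 8 (q · 𝟏)) }
    ; -‿homo = λ _ → refl
    ; 0-homo = refl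
    ; 1-homo = refl
    }

  open Algebra.Solver.Ring _ (fromCommutativeSemiring K-commutativeSemiring) morphism
    (λ p q → dec⇒maybe (p · 𝟏 ≟ q · 𝟏)) public

open Solver using (Polynomial; solve; con; _:=_; _:+_; _:*_)

-- Frobenius maps and inverses.

-- Naming the square lets evaluation share its argument.
square : K → K
square v = v * v

-- Transparent powers would make the type checker expand v^2^j.
opaque
  frob : ℕ → K → K
  frob zero    v = v
  frob (suc j) v = square (frob j v)

  frob-+ : ∀ j u v → frob j (u + v) ≡ frob j u + frob j v
  frob-+ zero    u v = refl
  frob-+ (suc j) u v = trans (cong square (frob-+ j u v))
    (solve 2 (λ u v → (u :+ v) :* (u :+ v) := u :* u :+ v :* v) refl (frob j u) (frob j v))

  frob-* : ∀ j u v → frob j (u * v) ≡ frob j u * frob j v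
  frob-* zero    u v = refl
  frob-* (suc j) u v = trans (cong square (frob-* j u v))
    (solve 2 (λ u v → (u :* v) :* (u :* v) := (u :* u) :* (v :* v)) refl (frob j u) (frob j v))

-- The power v²⁵⁴, as 2 + 4 + ... + 128 = 254.
reciprocal : K → K
reciprocal v = frob 1 v * frob 2 v * frob 3 v * frob 4 v * frob 5 v * frob 6 v * frob 7 v

opaque
  unfolding frob

  invertible : ∀ v → v ≡ 𝟎 ⊎ ∃[ w ] w * v ≡ 𝟏
  invertible v = Sum.map₂ (reciprocal v ,_)
    (∀-by-evaluation {P = λ v → v ≡ 𝟎 ⊎ reciprocal v * v ≡ 𝟏}
      (λ v → (v ≟ 𝟎) ⊎-dec (reciprocal v * v ≟ 𝟏)) refl v)

cancelˡ : ∀ w u → w * u ≡ 𝟏 → ∀ v → w * (u * v) ≡ v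
cancelˡ w u wu≡𝟏 v = trans (sym (horner-* w u v)) (trans (cong (_* v) wu≡𝟏) (*-identityˡ v))

*-nonzero : ∀ {u v} → u ≢ 𝟎 → v ≢ 𝟎 → u * v ≢ 𝟎
*-nonzero {u} {v} u≢𝟎 v≢𝟎 uv≡𝟎 with invertible u
... | inj₁ u≡𝟎         = u≢𝟎 u≡𝟎
... | inj₂ (w , wu≡𝟏) = v≢𝟎 (begin
  v            ≡⟨ cancelˡ w u wu≡𝟏 v ⟨
  w * (u * v)  ≡⟨ cong (w *_) uv≡𝟎 ⟩
  w * 𝟎        ≡⟨ horner-zeroʳ w ⟩
  𝟎            ∎)
  where open ≡-Reasoning

-- Spans, bases and quotients over F₂.

lin : Bits k → Vec (Bits n) k → Bits n
lin []       []       = 𝟎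
lin (c ∷ cs) (b ∷ bs) = c · b + lin cs bs

lin-+ : (cs ds : Bits k) (bs : Vec (Bits n) k) → lin (cs + ds) bs ≡ lin cs bs + lin ds bs
lin-+ []       []       []       = sym (+-self 𝟎)
lin-+ (c ∷ cs) (d ∷ ds) (b ∷ bs) =
  trans (cong₂ _+_ (·-+ˡ c d b) (lin-+ cs ds bs)) (+-interchange (c · b) (d · b) _ _)

lin-𝟎 : (bs : Vec (Bits n) k) → lin 𝟎 bs ≡ 𝟎
lin-𝟎 []       = refl
lin-𝟎 (b ∷ bs) = trans (+-identityˡ _) (lin-𝟎 bs)

lin-· : ∀ c (cs : Bits k) (bs : Vec (Bits n) k) → lin (c · cs) bs ≡ c · lin cs bs
lin-· true  cs bs = refl
lin-· false cs bs = lin-𝟎 bs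

lin-lin : (cs : Bits k) {m : ℕ} (ds : Vec (Bits m) k) (bs : Vec (Bits n) m) →
  lin cs (Vec.map (λ d → lin d bs) ds) ≡ lin (lin cs ds) bs
lin-lin []       []       bs = sym (lin-𝟎 bs)
lin-lin (c ∷ cs) (d ∷ ds) bs =
  trans (cong₂ _+_ (sym (lin-· c d bs)) (lin-lin cs ds bs)) (sym (lin-+ (c · d) (lin cs ds) bs))

infix 4 _∈⟨_⟩
_∈⟨_⟩ : Bits n → Vec (Bits n) k → Set
v ∈⟨ bs ⟩ = ∃[ c ] v ≡ lin c bs

record Closed (P : Bits n → Set) : Set where
  field
    𝟎-closed : P 𝟎
    +-closed : ∀ {u v} → P u → P v → P (u + v)

  ·-closed : ∀ c {v} → P v → P (c · v)
  ·-closed true  p = p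
  ·-closed false p = 𝟎-closed

  ⟨⟩-closed : {bs : Vec (Bits n) k} → All P bs → ∀ {v} → v ∈⟨ bs ⟩ → P v
  ⟨⟩-closed []       ([]     , refl) = 𝟎-closed
  ⟨⟩-closed (p ∷ ps) (c ∷ cs , refl) = +-closed (·-closed c p) (⟨⟩-closed ps (cs , refl))

open Closed

span-closed : (bs : Vec (Bits n) k) → Closed (_∈⟨ bs ⟩)
span-closed bs = record
  { 𝟎-closed = 𝟎 , sym (lin-𝟎 bs)
  ; +-closed = λ { (c , refl) (d , refl) → c + d , sym (lin-+ c d bs) }
  }

generator : (bs : Vec (Bits n) k) (i : Fin k) → lookup bs i ∈⟨ bs ⟩
generator (b ∷ bs) zero    = true ∷ 𝟎 , sym (trans (cong (b +_) (lin-𝟎 bs)) (+-identityʳ b))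
generator (b ∷ bs) (suc i) with c , eq ← generator bs i = false ∷ c , trans eq (sym (+-identityˡ _))

∈⟨∷⟩ : ∀ {b v : Bits n} {bs : Vec (Bits n) k} → v ∈⟨ bs ⟩ → v ∈⟨ b ∷ bs ⟩
∈⟨∷⟩ (c , refl) = false ∷ c , sym (+-identityˡ _)

Independent : Vec (Bits n) k → Set
Independent bs = ∀ c → lin c bs ≡ 𝟎 → c ≡ 𝟎

independent-∷⁺ : ∀ {w : Bits n} {bs : Vec (Bits n) k} → ¬ w ∈⟨ bs ⟩ → Independent bs → Independent (w ∷ bs)
independent-∷⁺ w∉ ind (true  ∷ c) eq = contradiction (c , x+y≡𝟎⇒x≡y _ _ eq) w∉
independent-∷⁺ w∉ ind (false ∷ c) eq = cong (false ∷_) (ind c (trans (sym (+-identityˡ _)) eq))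

independent-∷⁻ : ∀ {w : Bits n} {bs : Vec (Bits n) k} → Independent (w ∷ bs) → ¬ w ∈⟨ bs ⟩
independent-∷⁻ {bs = bs} ind (c , refl) with () ← ind (true ∷ c) (+-self (lin c bs))

span? : (bs : Vec (Bits n) k) → Decidable (_∈⟨ bs ⟩)
span? bs v = ∃? λ c → v ≟ lin c bs

Spanning : Vec (Bits n) k → Set
Spanning bs = ∀ v → v ∈⟨ bs ⟩

independent? : (bs : Vec (Bits n) k) → Dec (Independent bs)
independent? bs = ∀? λ c → (lin c bs ≟ 𝟎) →-dec (c ≟ 𝟎)

abstract
  F₂³-extension : (r s : Bits 3) → Independent (r ∷ s ∷ []) →
    ∃[ t ] Independent (t ∷ r ∷ s ∷ []) × Spanning (t ∷ r ∷ s ∷ [])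
  F₂³-extension = ∀-by-evaluation {P = λ r → ∀ s → Independent (r ∷ s ∷ []) →
      ∃[ t ] Independent (t ∷ r ∷ s ∷ []) × Spanning (t ∷ r ∷ s ∷ [])}
    (λ r → ∀? λ s → independent? (r ∷ s ∷ []) →-dec
      ∃? λ t → independent? (t ∷ r ∷ s ∷ []) ×-dec ∀? (span? (t ∷ r ∷ s ∷ []))) refl

-- The coordinates of `a` and `b` with respect to `bs` lie in F₂³, where an exhaustive search has
-- settled the extension. The vector found there is carried back along `bs`.
basis-extension : {bs : Vec (Bits n) 3} {a b : Bits n} → Independent bs → a ∈⟨ bs ⟩ → b ∈⟨ bs ⟩ →
  Independent (a ∷ b ∷ []) →
  ∃[ w ] w ∈⟨ bs ⟩ × Independent (w ∷ a ∷ b ∷ []) × (∀ {v} → v ∈⟨ bs ⟩ → v ∈⟨ w ∷ a ∷ b ∷ [] ⟩)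
basis-extension {bs = bs} ind-bs (r , refl) (s , refl) ind-ab =
  let t , ind-trs , span-trs = F₂³-extension r s λ c eq →
        ind-ab c (trans (lin-lin c (r ∷ s ∷ []) bs) (trans (cong (λ d → lin d bs) eq) (lin-𝟎 bs)))
  in lin t bs , (t , refl)
   , (λ c eq → ind-trs c (ind-bs _ (trans (sym (lin-lin c (t ∷ r ∷ s ∷ []) bs)) eq)))
   , λ { (d , refl) → let c , eq = span-trs d in
         c , trans (cong (λ e → lin e bs) eq) (sym (lin-lin c (t ∷ r ∷ s ∷ []) bs)) }

-- The quotient of F₂ⁿ⁺¹ by the line of z ≠ 0, with a section of it: the coordinate where z
-- first differs from 0 is cleared and dropped.

quot : Bits (suc n) → Bits (suc n) → Bits n
quot             (true  ∷ z) (p ∷ y) = y + p · z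
quot {n = zero}  (false ∷ z) (p ∷ y) = []
quot {n = suc _} (false ∷ z) (p ∷ y) = p ∷ quot z y

section : Bits (suc n) → Bits n → Bits (suc n)
section (true  ∷ z) y       = false ∷ y
section (false ∷ z) []      = false ∷ []
section (false ∷ z) (p ∷ y) = p ∷ section z y

quot-section : (z : Bits (suc n)) (y : Bits n) → quot z (section z y) ≡ y
quot-section (true  ∷ z) y       = +-identityʳ y
quot-section (false ∷ z) []      = refl
quot-section (false ∷ z) (p ∷ y) = cong (p ∷_) (quot-section z y)

quot-+ : (z x y : Bits (suc n)) → quot z (x + y) ≡ quot z x + quot z y
quot-+             (true  ∷ z) (p ∷ x) (q ∷ y) =
  trans (cong ((x + y) +_) (·-+ˡ p q z)) (+-interchange x y (p · z) (q · z))
quot-+ {n = zero}  (false ∷ z) (p ∷ x) (q ∷ y) = refl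
quot-+ {n = suc _} (false ∷ z) (p ∷ x) (q ∷ y) = cong ((p xor q) ∷_) (quot-+ z x y)

quot-self : (z : Bits (suc n)) → quot z z ≡ 𝟎
quot-self             (true  ∷ z) = +-self z
quot-self {n = zero}  (false ∷ z) = refl
quot-self {n = suc _} (false ∷ z) = cong (false ∷_) (quot-self z)

quot-kernel : (z : Bits (suc n)) → z ≢ 𝟎 → ∀ x → quot z x ≡ 𝟎 → ∃[ p ] x ≡ p · z
quot-kernel (true ∷ z) z≢𝟎 (true  ∷ x) eq = true , cong (true ∷_) (x+y≡𝟎⇒x≡y x z eq)
quot-kernel (true ∷ z) z≢𝟎 (false ∷ x) eq = false , cong (false ∷_) (x+y≡𝟎⇒x≡y x 𝟎 eq)
quot-kernel {n = zero}  (false ∷ []) z≢𝟎 x       eq = contradiction refl z≢𝟎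
quot-kernel {n = suc _} (false ∷ z)  z≢𝟎 (p ∷ x) eq
  with refl ← cong Vec.head eq
  with quot-kernel z (z≢𝟎 ∘ cong (false ∷_)) x (cong tail eq)
... | true  , refl = true , refl
... | false , refl = false , refl

-- Moore determinants and alternating forms.

Triple : Set → Set
Triple A = A × A × A

_+³_ : Triple K → Triple K → Triple K
(a , a′ , a″) +³ (b , b′ , b″) = a + b , a′ + b′ , a″ + b″

_*³_ : Triple K → Triple K → Triple K
(a , a′ , a″) *³ (b , b′ , b″) = a * b , a′ * b′ , a″ * b″

minors : Triple K → Triple K → Triple K
minors (a , a′ , a″) (b , b′ , b″) = a′ * b″ + a″ * b′ , a * b″ + a″ * b , a * b′ + a′ * b

dot : Triple K → Triple K → K
dot (a , a′ , a″) (b , b′ , b″) = a * b + a′ * b′ + a″ * b″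

-- Expansion along `c`. In characteristic 2 the cofactors carry no signs.
det : Triple K → Triple K → Triple K → K
det c a b = dot (minors a b) c

module _ {m : ℕ} where
  :det : (c c′ c″ a a′ a″ b b′ b″ : Polynomial m) → Polynomial m
  :det c c′ c″ a a′ a″ b b′ b″ =
    (a′ :* b″ :+ a″ :* b′) :* c :+ (a :* b″ :+ a″ :* b) :* c′ :+ (a :* b′ :+ a′ :* b) :* c″

det-+ : ∀ x a b c → det (x +³ a) b c ≡ det x b c + det a b c
det-+ (x , x′ , x″) (a , a′ , a″) (b , b′ , b″) (c , c′ , c″) =
  solve 12 (λ x x′ x″ a a′ a″ b b′ b″ c c′ c″ →
    :det (x :+ a) (x′ :+ a′) (x″ :+ a″) b b′ b″ c c′ c″ :=
    :det x x′ x″ b b′ b″ c c′ c″ :+ :det a a′ a″ b b′ b″ c c′ c″)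
    refl x x′ x″ a a′ a″ b b′ b″ c c′ c″

det-*³ : ∀ x x′ x″ a b c → let t = x , x′ , x″ in
  det (t *³ a) (t *³ b) (t *³ c) ≡ x * x′ * x″ * det a b c
det-*³ x x′ x″ (a , a′ , a″) (b , b′ , b″) (c , c′ , c″) =
  solve 12 (λ x x′ x″ a a′ a″ b b′ b″ c c′ c″ →
    :det (x :* a) (x′ :* a′) (x″ :* a″) (x :* b) (x′ :* b′) (x″ :* b″) (x :* c) (x′ :* c′) (x″ :* c″) :=
    x :* x′ :* x″ :* :det a a′ a″ b b′ b″ c c′ c″)
    refl x x′ x″ a a′ a″ b b′ b″ c c′ c″

det-swap₁₂ : ∀ a b c → det a b c ≡ det b a c
det-swap₁₂ (a , a′ , a″) (b , b′ , b″) (c , c′ , c″) =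
  solve 9 (λ a a′ a″ b b′ b″ c c′ c″ →
    :det a a′ a″ b b′ b″ c c′ c″ := :det b b′ b″ a a′ a″ c c′ c″)
    refl a a′ a″ b b′ b″ c c′ c″

det-swap₂₃ : ∀ a b c → det a b c ≡ det a c b
det-swap₂₃ (a , a′ , a″) (b , b′ , b″) (c , c′ , c″) =
  solve 9 (λ a a′ a″ b b′ b″ c c′ c″ →
    :det a a′ a″ b b′ b″ c c′ c″ := :det a a′ a″ c c′ c″ b b′ b″)
    refl a a′ a″ b b′ b″ c c′ c″

det-diagonal : ∀ a c → det a a c ≡ 𝟎
det-diagonal (a , a′ , a″) (c , c′ , c″) =
  solve 6 (λ a a′ a″ c c′ c″ → :det a a′ a″ a a′ a″ c c′ c″ := con false) refl a a′ a″ c c′ c″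

-- Frobenius powers are additive, so these Moore determinants are F₂-multilinear in a, b, c.

conjugates : ℕ → ℕ → K → Triple K
conjugates j k v = v , frob j v , frob k v

moore : ℕ → ℕ → K → K → K → K
moore j k c a b = det (conjugates j k c) (conjugates j k a) (conjugates j k b)

conjugates-+ : ∀ j k u v → conjugates j k (u + v) ≡ conjugates j k u +³ conjugates j k v
conjugates-+ j k u v = cong₂ (λ x y → u + v , x , y) (frob-+ j u v) (frob-+ k u v)

conjugates-* : ∀ j k u v → conjugates j k (u * v) ≡ conjugates j k u *³ conjugates j k v
conjugates-* j k u v = cong₂ (λ x y → u * v , x , y) (frob-* j u v) (frob-* k u v)

moore-* : ∀ j k x c a b →
  moore j k (x * c) (x * a) (x * b) ≡ x * frob j x * frob k x * moore j k c a b
moore-* j k x c a b = trans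
  (trans (cong₂ (λ t u → det t u (conjugates j k (x * b))) (conjugates-* j k x c) (conjugates-* j k x a))
    (cong (det (scale c) (scale a)) (conjugates-* j k x b)))
  (det-*³ x (frob j x) (frob k x) (conjugates j k c) (conjugates j k a) (conjugates j k b))
  where
  scale : K → Triple K
  scale v = conjugates j k x *³ conjugates j k v

-- In characteristic 2 the sign change under a swap is invisible, so vanishing on equal arguments
-- does not follow from the swaps and is a separate field.
record Alternating (D : K → K → K → K) : Set where
  field
    additive : ∀ x a b c → D (x + a) b c ≡ D x b c + D a b c
    swap₁₂   : ∀ a b c → D a b c ≡ D b a c
    swap₂₃   : ∀ a b c → D a b c ≡ D a c b
    diagonal : ∀ a c → D a a c ≡ 𝟎

moore-alternating : ∀ j k → Alternating (moore j k)
moore-alternating j k = record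
  { additive = λ x a b c → trans (cong (λ t → det t (κ b) (κ c)) (conjugates-+ j k x a))
                                 (det-+ (κ x) (κ a) (κ b) (κ c))
  ; swap₁₂   = λ a b c → det-swap₁₂ (κ a) (κ b) (κ c)
  ; swap₂₃   = λ a b c → det-swap₂₃ (κ a) (κ b) (κ c)
  ; diagonal = λ a c → det-diagonal (κ a) (κ c)
  }
  where
  κ = conjugates j k

module AlternatingProperties {D : K → K → K → K} (alternating : Alternating D) where
  open Alternating alternating

  infix 4 _∈₂_
  -- The F₂-multiples of `d`.
  _∈₂_ : K → K → Set
  v ∈₂ d = v ≡ 𝟎 ⊎ v ≡ d

  ∈₂-+ : ∀ {u v d} → u ∈₂ d → v ∈₂ d → u + v ∈₂ d
  ∈₂-+ (inj₁ refl) q           = subst (_∈₂ _) (sym (+-identityˡ _)) q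
  ∈₂-+ (inj₂ refl) (inj₁ refl) = inj₂ (+-identityʳ _)
  ∈₂-+ (inj₂ refl) (inj₂ refl) = inj₁ (+-self _)

  zero₁ : ∀ b c → D 𝟎 b c ≡ 𝟎
  zero₁ b c = trans (additive 𝟎 𝟎 b c) (+-self _)

  values₁ : ∀ {b c d} → Closed (λ v → D v b c ∈₂ d)
  values₁ {b} {c} = record
    { 𝟎-closed = inj₁ (zero₁ b c)
    ; +-closed = λ {u} {v} p q → subst (_∈₂ _) (sym (additive u v b c)) (∈₂-+ p q)
    }

  rotate : ∀ a b c → D a b c ≡ D c a b
  rotate a b c = trans (swap₂₃ a b c) (swap₁₂ a c b)

  equal₁₂ : ∀ {a c d} → D a a c ∈₂ d
  equal₁₂ = inj₁ (diagonal _ _)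

  equal₁₃ : ∀ {a b d} → D a b a ∈₂ d
  equal₁₃ = inj₁ (trans (swap₂₃ _ _ _) (diagonal _ _))

  equal₂₃ : ∀ {a b d} → D a b b ∈₂ d
  equal₂₃ = inj₁ (trans (rotate _ _ _) (trans (swap₂₃ _ _ _) (diagonal _ _)))

  module _ (a b c : K) where
    private
      B : Vec K 3
      B = a ∷ b ∷ c ∷ []

      d : K
      d = D a b c

    expand : ∀ {x y z} → (∀ i → D (lookup B i) y z ∈₂ d) → x ∈⟨ B ⟩ → D x y z ∈₂ d
    expand {x} {y} {z} p = ⟨⟩-closed {P = λ v → D v y z ∈₂ d} values₁ (p zero ∷ p (suc zero) ∷ p (suc (suc zero)) ∷ [])

    generator-value : ∀ i j l → D (lookup B i) (lookup B j) (lookup B l) ∈₂ d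
    generator-value zero             zero             l                = equal₁₂
    generator-value zero             (suc zero)       zero             = equal₁₃
    generator-value zero             (suc zero)       (suc zero)       = equal₂₃
    generator-value zero             (suc zero)       (suc (suc zero)) = inj₂ refl
    generator-value zero             (suc (suc zero)) zero             = equal₁₃
    generator-value zero             (suc (suc zero)) (suc zero)       = inj₂ (swap₂₃ a c b)
    generator-value zero             (suc (suc zero)) (suc (suc zero)) = equal₂₃
    generator-value (suc zero)       zero             zero             = equal₂₃
    generator-value (suc zero)       zero             (suc zero)       = equal₁₃
    generator-value (suc zero)       zero             (suc (suc zero)) = inj₂ (swap₁₂ b a c)
    generator-value (suc zero)       (suc zero)       l                = equal₁₂
    generator-value (suc zero)       (suc (suc zero)) zero             = inj₂ (rotate b c a)
    generator-value (suc zero)       (suc (suc zero)) (suc zero)       = equal₁₃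
    generator-value (suc zero)       (suc (suc zero)) (suc (suc zero)) = equal₂₃
    generator-value (suc (suc zero)) zero             zero             = equal₂₃
    generator-value (suc (suc zero)) zero             (suc zero)       = inj₂ (sym (rotate a b c))
    generator-value (suc (suc zero)) zero             (suc (suc zero)) = equal₁₃
    generator-value (suc (suc zero)) (suc zero)       zero             = inj₂ (trans (swap₁₂ c b a) (rotate b c a))
    generator-value (suc (suc zero)) (suc zero)       (suc zero)       = equal₂₃
    generator-value (suc (suc zero)) (suc zero)       (suc (suc zero)) = equal₁₃
    generator-value (suc (suc zero)) (suc (suc zero)) l                = equal₁₂

    -- Additivity is available in the first argument only, so the arguments are rotated into that
    -- place and expanded one after another. This leaves the 27 values on basis vectors.
    span-value : ∀ {x y z} → x ∈⟨ B ⟩ → y ∈⟨ B ⟩ → z ∈⟨ B ⟩ → D x y z ∈₂ d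
    span-value x∈ y∈ z∈ =
      expand (λ i → rotated (expand (λ j → rotated (expand (λ l → generator-value l i j) z∈)) y∈)) x∈
      where
      rotated : ∀ {x y z} → D y z x ∈₂ d → D x y z ∈₂ d
      rotated = subst (_∈₂ d) (rotate _ _ _)

  -- Each of the two values is 0 or equal to the other, by `span-value` in both directions, and this
  -- forces equality. It stands in for the fact that every invertible matrix over F₂ has determinant
  -- 1.
  span-equal : ∀ {a b c x y z} →
    All (_∈⟨ a ∷ b ∷ c ∷ [] ⟩) (x ∷ y ∷ z ∷ []) → All (_∈⟨ x ∷ y ∷ z ∷ [] ⟩) (a ∷ b ∷ c ∷ []) →
    D x y z ≡ D a b c
  span-equal {a} {b} {c} {x} {y} {z} (x∈ ∷ y∈ ∷ z∈ ∷ []) (a∈ ∷ b∈ ∷ c∈ ∷ [])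
    with span-value a b c x∈ y∈ z∈
  ... | inj₂ eq = eq
  ... | inj₁ xyz≡𝟎 with span-value x y z a∈ b∈ c∈
  ...   | inj₁ abc≡𝟎 = trans xyz≡𝟎 (sym abc≡𝟎)
  ...   | inj₂ eq    = sym eq

  vanishes : ∀ {a b c} → c ∈⟨ a ∷ b ∷ [] ⟩ → D c a b ≡ 𝟎
  vanishes {a} {b} = ⟨⟩-closed {P = λ c → D c a b ≡ 𝟎} record
    { 𝟎-closed = zero₁ a b
    ; +-closed = λ p q → trans (additive _ _ a b) (trans (cong₂ _+_ p q) (+-self 𝟎))
    } (diagonal a b ∷ trans (swap₂₃ b a b) (diagonal b a) ∷ [])

-- Nonvanishing of the first Moore determinant.

combinations : ∀ k → List (Bits k)
combinations zero    = [] ∷ []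
combinations (suc k) = List.map (false ∷_) (combinations k) ++ List.map (true ∷_) (combinations k)

product : List K → K
product = List.foldr _*_ 𝟏

product-nonzero : ∀ {vs} → ListAll.All (_≢ 𝟎) vs → product vs ≢ 𝟎
product-nonzero ListAll.[]       ()
product-nonzero (v≢𝟎 ListAll.∷ vs) = *-nonzero v≢𝟎 (product-nonzero vs)

opaque
  unfolding frob

  -- Moore's factorisation into linear forms. The entry that `List.drop 1` removes is the zero
  -- combination.
  moore-product : ∀ c a b →
    moore 1 2 c a b ≡ product (List.map (λ p → lin p (c ∷ a ∷ b ∷ [])) (List.drop 1 (combinations 3)))
  moore-product = solve 3 (λ c a b →
    let infixl 9 _:²
        _:² : Polynomial 3 → Polynomial 3
        v :² = v :* v
        term : Bool → Polynomial 3 → Polynomial 3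
        term p v = if p then v else con false
        :lin : Bool → Bool → Bool → Polynomial 3
        :lin p q r = term p c :+ (term q a :+ (term r b :+ con false))
    in :det c (c :²) (c :² :²) a (a :²) (a :² :²) b (b :²) (b :² :²) :=
       -- The factors follow the order of `combinations 3`, and the final 𝟎 of `lin` and 𝟏 of
       -- `product` are kept, so that the polynomial evaluates to exactly the required expression.
       :lin false false true :* (:lin false true false :* (:lin false true true :* (:lin true false false :*
         (:lin true false true :* (:lin true true false :* (:lin true true true :* con true))))))) refl

-- Needed so that a plane never gets the colour `𝟎`: `χ` takes cube roots of unity as values only
-- away from `𝟎`.
moore-nonzero : ∀ {c a b} → Independent (c ∷ a ∷ b ∷ []) → moore 1 2 c a b ≢ 𝟎
moore-nonzero {c} {a} {b} ind eq = product-nonzero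
  (ListAll.map⁺ (ListAll.map (λ p≢𝟎 → p≢𝟎 ∘ ind _)
    (from-yes (ListAll.all? (λ p → ¬? (p ≟ 𝟎)) (List.drop 1 (combinations 3))))))
  (trans (sym (moore-product c a b)) eq)

-- The colour of a plane and its behaviour under scaling.

-- The powers v⁸⁵ and v⁷¹.

χ : K → K
χ v = v * frob 2 v * frob 4 v * frob 6 v

ψ : K → K
ψ v = v * frob 1 v * frob 2 v * frob 6 v

-- The cube roots of unity, which are the nonzero elements of the subfield F₄.
ω^ : Fin 3 → K
ω^ zero             = 𝟏
ω^ (suc zero)       = false ∷ true ∷ true ∷ false ∷ true ∷ false ∷ true ∷ true ∷ []
ω^ (suc (suc zero)) = true ∷ true ∷ true ∷ false ∷ true ∷ false ∷ true ∷ true ∷ []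

-- The first coordinate is the most significant bit.
value : Bits n → ℕ
value = foldl _ (λ m b → if b then 1 ℕ.+ 2 ℕ.* m else 2 ℕ.* m) 0

-- The values of μ are the base 3 digits of this number, which was found by a computer search.

table : ℕ
table = 20701873162760446293545428515097906583512264413962612802336283667574044866640627228062857361862711667133287783074200675290

opaque
  digit : K → Fin 3
  digit v = _mod_ ((table / 3 ℕ.^ value v) ⦃ ℕ.m^n≢0 3 (value v) ⦄) 3

μ : K → K
μ v = ω^ (digit v)

-- The functions on K that enter a colour are parameters, so that they can be tabulated.

record Ingredients : Set where
  constructor ingredients
  field
    conj₁₂ conj₂₃ : K → Triple K
    X Y M         : K → K

  hue : K → K → K
  hue u v = X u * M (Y u * v)

  shade : Triple K → Triple K → K → K
  shade m m′ c = hue (dot m (conj₁₂ c)) (dot m′ (conj₂₃ c))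

  over : K → K → K → K
  over a b = shade (minors (conj₁₂ a) (conj₁₂ b)) (minors (conj₂₃ a) (conj₂₃ b))

exact : Ingredients
exact = ingredients (conjugates 1 2) (conjugates 2 3) χ ψ μ

open Ingredients exact using (hue)

colour : K → K → K → K
colour c a b = Ingredients.over exact a b c

colour-basis : ∀ {a b c x y z} →
  All (_∈⟨ a ∷ b ∷ c ∷ [] ⟩) (x ∷ y ∷ z ∷ []) → All (_∈⟨ x ∷ y ∷ z ∷ [] ⟩) (a ∷ b ∷ c ∷ []) →
  colour x y z ≡ colour a b c
colour-basis p q = cong₂ hue (span-equal (moore-alternating 1 2) p q) (span-equal (moore-alternating 2 3) p q)
  where open AlternatingProperties

colour-degenerate : ∀ {a b c} → c ∈⟨ a ∷ b ∷ [] ⟩ → colour c a b ≡ 𝟎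
-- `hue 𝟎 𝟎` reduces to `𝟎` because its left factor `χ 𝟎` does.
colour-degenerate p = cong₂ hue (vanishes (moore-alternating 1 2) p) (vanishes (moore-alternating 2 3) p)
  where open AlternatingProperties

χ-* : ∀ u v → χ (u * v) ≡ χ u * χ v
χ-* u v rewrite frob-* 2 u v | frob-* 4 u v | frob-* 6 u v =
  solve 8 (λ a b c d a′ b′ c′ d′ →
    (a :* a′) :* (b :* b′) :* (c :* c′) :* (d :* d′) := (a :* b :* c :* d) :* (a′ :* b′ :* c′ :* d′))
    refl u (frob 2 u) (frob 4 u) (frob 6 u) v (frob 2 v) (frob 4 v) (frob 6 v)

ψ-* : ∀ u v → ψ (u * v) ≡ ψ u * ψ v
ψ-* u v rewrite frob-* 1 u v | frob-* 2 u v | frob-* 6 u v =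
  solve 8 (λ a b c d a′ b′ c′ d′ →
    (a :* a′) :* (b :* b′) :* (c :* c′) :* (d :* d′) := (a :* b :* c :* d) :* (a′ :* b′ :* c′ :* d′))
    refl u (frob 1 u) (frob 2 u) (frob 6 u) v (frob 1 v) (frob 2 v) (frob 6 v)

-- Here `l` and `m` are the factors by which the two determinants scale. The hypothesis keeps the
-- argument of `μ` fixed, so nothing about the values of `μ` enters.
hue-* : ∀ l m u v → ψ l * m ≡ 𝟏 → hue (l * u) (m * v) ≡ χ l * hue u v
hue-* l m u v eq = begin
  χ (l * u) * μ (ψ (l * u) * (m * v))    ≡⟨ cong₂ (λ x y → x * μ (y * (m * v))) (χ-* l u) (ψ-* l u) ⟩
  χ l * χ u * μ (ψ l * ψ u * (m * v))    ≡⟨ cong (λ x → χ l * χ u * μ x) regroup ⟩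
  χ l * χ u * μ (ψ l * m * (ψ u * v))    ≡⟨ cong (λ x → χ l * χ u * μ (x * (ψ u * v))) eq ⟩
  χ l * χ u * μ (𝟏 * (ψ u * v))          ≡⟨ cong (λ x → χ l * χ u * μ x) (*-identityˡ (ψ u * v)) ⟩
  χ l * χ u * μ (ψ u * v)                ≡⟨ horner-* (χ l) (χ u) (μ (ψ u * v)) ⟩
  χ l * (χ u * μ (ψ u * v))              ∎
  where
  open ≡-Reasoning
  regroup : ψ l * ψ u * (m * v) ≡ ψ l * m * (ψ u * v)
  regroup = solve 4 (λ a b c d → a :* b :* (c :* d) := a :* c :* (b :* d)) refl (ψ l) (ψ u) m v

norm₁₂ norm₂₃ : K → K
norm₁₂ x = x * frob 1 x * frob 2 x
norm₂₃ x = x * frob 2 x * frob 3 x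

colour-* : ∀ x c a b → ψ (norm₁₂ x) * norm₂₃ x ≡ 𝟏 →
  colour (x * c) (x * a) (x * b) ≡ χ (norm₁₂ x) * colour c a b
colour-* x c a b eq = trans
  (cong₂ hue (moore-* 1 2 x c a b) (moore-* 2 3 x c a b))
  (hue-* (norm₁₂ x) (norm₂₃ x) (moore 1 2 c a b) (moore 2 3 c a b) eq)

opaque
  unfolding frob

  -- As `norm₁₂ x` is x⁷ and `norm₂₃ x` is x¹³, the two claims concern x⁵¹⁰ = 1 and x⁵⁹⁵ = x⁸⁵.
  degree : ∀ x → x ≡ 𝟎 ⊎ (ψ (norm₁₂ x) * norm₂₃ x ≡ 𝟏 × ∃[ i ] χ (norm₁₂ x) ≡ ω^ i)
  degree = ∀-by-evaluation {P = λ x → x ≡ 𝟎 ⊎ (ψ (norm₁₂ x) * norm₂₃ x ≡ 𝟏 × ∃[ i ] χ (norm₁₂ x) ≡ ω^ i)}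
    (λ x → (x ≟ 𝟎) ⊎-dec ((ψ (norm₁₂ x) * norm₂₃ x ≟ 𝟏) ×-dec Fin.any? λ i → χ (norm₁₂ x) ≟ ω^ i)) refl

  χ-value : ∀ v → v ≡ 𝟎 ⊎ ∃[ i ] χ v ≡ ω^ i
  χ-value = ∀-by-evaluation {P = λ v → v ≡ 𝟎 ⊎ ∃[ i ] χ v ≡ ω^ i}
    (λ v → (v ≟ 𝟎) ⊎-dec Fin.any? λ i → χ v ≟ ω^ i) refl

ω^-* : ∀ i j → ∃[ k ] ω^ i * ω^ j ≡ ω^ k
ω^-* = from-yes (Fin.all? λ i → Fin.all? λ j → Fin.any? λ k → ω^ i * ω^ j ≟ ω^ k)

ω^-divides : ∀ i j → ∃[ k ] ω^ i * ω^ k ≡ ω^ j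
ω^-divides = from-yes (Fin.all? λ i → Fin.all? λ j → Fin.any? λ k → ω^ i * ω^ k ≟ ω^ j)

ω^-injective : ∀ i j → ω^ i ≡ ω^ j → i ≡ j
ω^-injective = from-yes (Fin.all? λ i → Fin.all? λ j → (ω^ i ≟ ω^ j) →-dec (i Fin.≟ j))

ω^≢𝟎 : ∀ i → ω^ i ≢ 𝟎
ω^≢𝟎 = from-yes (Fin.all? λ i → ¬? (ω^ i ≟ 𝟎))

ω^-cancelˡ : ∀ i {u v} → ω^ i * u ≡ ω^ i * v → u ≡ v
ω^-cancelˡ i {u} {v} eq with invertible (ω^ i)
... | inj₁ ω^i≡𝟎        = contradiction ω^i≡𝟎 (ω^≢𝟎 i)
... | inj₂ (w , wω^i≡𝟏) = trans (sym (cancelˡ w (ω^ i) wω^i≡𝟏 u)) (trans (cong (w *_) eq) (cancelˡ w (ω^ i) wω^i≡𝟏 v))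

hue-value : ∀ u v → u ≢ 𝟎 → ∃[ i ] hue u v ≡ ω^ i
hue-value u v u≢𝟎 with χ-value u
... | inj₁ u≡𝟎      = contradiction u≡𝟎 u≢𝟎
... | inj₂ (i , eq) = let k , eq′ = ω^-* i (digit (ψ u * v)) in k , trans (cong (_* μ (ψ u * v)) eq) eq′

colour-value : ∀ {a b c} → Independent (c ∷ a ∷ b ∷ []) → ∃[ i ] colour c a b ≡ ω^ i
colour-value {a} {b} {c} ind = hue-value (moore 1 2 c a b) (moore 2 3 c a b) (moore-nonzero ind)

-- The evaluated check above the lines through 1.

-- Evaluation builds a trie once and then looks up the values of f.

data Trie (A : Set) : ℕ → Set where
  leaf : A → Trie A zero
  node : Trie A n → Trie A n → Trie A (suc n)

trie : {A : Set} → (Bits n → A) → Trie A n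
trie {n = zero}  f = leaf (f [])
trie {n = suc _} f = node (trie (f ∘ (false ∷_))) (trie (f ∘ (true ∷_)))

look : {A : Set} → Trie A n → Bits n → A
look (leaf a)   []          = a
look (node s t) (false ∷ v) = look s v
look (node s t) (true  ∷ v) = look t v

look-trie : {A : Set} (f : Bits n → A) → ∀ v → look (trie f) v ≡ f v
look-trie f []          = refl
look-trie f (false ∷ v) = look-trie (f ∘ (false ∷_)) v
look-trie f (true  ∷ v) = look-trie (f ∘ (true ∷_)) v

-- The list has 64 entries for 63 planes. The entry for y = `𝟎` belongs to a degenerate triple and
-- has the colour `𝟎`, so it is counted for none of the three cube roots of unity.
line-colours : Ingredients → Bits 7 → List K
line-colours I z = List.map (λ y → Ingredients.over I 𝟏 (false ∷ z) (false ∷ section z y)) (combinations 6)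

Balanced : List K → Set
Balanced cs = ∀ i → length (filter (_≟ ω^ i) cs) ≡ 21

balanced? : Decidable Balanced
balanced? cs = Fin.all? λ i → length (filter (_≟ ω^ i) cs) ℕ.≟ 21

allᵇ : (Bits n → Bool) → Bool
allᵇ {zero}  p = p []
allᵇ {suc n} p = allᵇ (p ∘ (false ∷_)) ∧ allᵇ (p ∘ (true ∷_))

allᵇ-sound : (p : Bits n → Bool) → allᵇ p ≡ true → ∀ v → p v ≡ true
allᵇ-sound p eq [] = eq
allᵇ-sound p eq (b ∷ v) with allᵇ (p ∘ (false ∷_)) in eq₀
allᵇ-sound p eq (false ∷ v) | true = allᵇ-sound (p ∘ (false ∷_)) eq₀ v
allᵇ-sound p eq (true  ∷ v) | true = allᵇ-sound (p ∘ (true ∷_)) eq v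

-- The tries are arguments so that one copy can serve all lines. For z = `𝟎` there is no line ⟨1, z⟩
-- to check.
line-check : (f g : Trie (Triple K) 8) (X Y M : Trie K 8) → Bits 7 → Bool
line-check f g X Y M z =
  does (z ≟ 𝟎) ∨ does (balanced? (line-colours (ingredients (look f) (look g) (look X) (look Y) (look M)) z))

opaque
  unfolding frob digit

  all-lines-checked :
    allᵇ (line-check (trie (conjugates 1 2)) (trie (conjugates 2 3)) (trie χ) (trie ψ) (trie μ)) ≡ true
  all-lines-checked = refl

tabulated : Ingredients
tabulated = ingredients (look (trie (conjugates 1 2))) (look (trie (conjugates 2 3)))
  (look (trie χ)) (look (trie ψ)) (look (trie μ))

tabulated-hue : ∀ u v → Ingredients.hue tabulated u v ≡ hue u v
tabulated-hue u v = cong₂ _*_ (look-trie χ u)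
  (trans (look-trie μ (look (trie ψ) u * v)) (cong (λ x → μ (x * v)) (look-trie ψ u)))

tabulated-over : ∀ a b c → Ingredients.over tabulated a b c ≡ colour c a b
tabulated-over a b c = trans (tabulated-hue (moore′ 1 2) (moore′ 2 3)) (cong₂ hue (moore′≡moore 1 2) (moore′≡moore 2 3))
  where
  κ : ℕ → ℕ → K → Triple K
  κ j k = look (trie (conjugates j k))
  moore′ : ℕ → ℕ → K
  moore′ j k = det (κ j k c) (κ j k a) (κ j k b)
  moore′≡moore : ∀ j k → moore′ j k ≡ moore j k c a b
  moore′≡moore j k = trans
    (cong₂ (λ t u → det t u (κ j k b)) (look-trie (conjugates j k) c) (look-trie (conjugates j k) a))
    (cong (det (conjugates j k c) (conjugates j k a)) (look-trie (conjugates j k) b))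

does-∨ : {A B : Set} (d : Dec A) (e : Dec B) → does d ∨ does e ≡ true → A ⊎ B
does-∨ (yes a) e       _ = inj₁ a
does-∨ (no _)  (yes b) _ = inj₂ b

length-filter-map : {A B : Set} {P : B → Set} (P? : Decidable P) (f : A → B) (xs : List A) →
  length (filter P? (List.map f xs)) ≡ length (filter (P? ∘ f) xs)
length-filter-map P? f []       = refl
length-filter-map P? f (x ∷ xs) with does (P? (f x))
... | true  = cong suc (length-filter-map P? f xs)
... | false = length-filter-map P? f xs

balanced : ∀ z → z ≢ 𝟎 → ∀ i →
  length (filter (λ y → colour (false ∷ section z y) 𝟏 (false ∷ z) ≟ ω^ i) (combinations 6)) ≡ 21
balanced z z≢𝟎 i = begin
  length (filter (λ y → colour (false ∷ section z y) 𝟏 (false ∷ z) ≟ ω^ i) (combinations 6))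
    ≡⟨ length-filter-map (_≟ ω^ i) (λ y → colour (false ∷ section z y) 𝟏 (false ∷ z)) (combinations 6) ⟨
  length (filter (_≟ ω^ i) (line-colours exact z))
    ≡⟨ cong (λ cs → length (filter (_≟ ω^ i) cs))
         (List.map-cong (λ y → tabulated-over 𝟏 (false ∷ z) (false ∷ section z y)) (combinations 6)) ⟨
  length (filter (_≟ ω^ i) (line-colours tabulated z))
    ≡⟨ tabulated-balanced (does-∨ (z ≟ 𝟎) (balanced? (line-colours tabulated z))
         (allᵇ-sound (line-check (trie (conjugates 1 2)) (trie (conjugates 2 3)) (trie χ) (trie ψ) (trie μ))
           all-lines-checked z)) ⟩
  21 ∎
  where
  open ≡-Reasoning
  tabulated-balanced : z ≡ 𝟎 ⊎ Balanced (line-colours tabulated z) →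
    length (filter (_≟ ω^ i) (line-colours tabulated z)) ≡ 21
  tabulated-balanced (inj₁ z≡𝟎) = contradiction z≡𝟎 z≢𝟎
  tabulated-balanced (inj₂ bal) = bal i

-- Transfer from lines through 1 to all lines.

tail-+ : (x y : Bits (suc n)) → tail (x + y) ≡ tail x + tail y
tail-+ (p ∷ x) (q ∷ y) = refl

-- In `K` the vector `true ∷ 𝟎` is 1, so dropping the first coordinate is passing to K/⟨1⟩.
head-split : (x : Bits (suc n)) → ∃[ p ] x ≡ p · (true ∷ 𝟎) + (false ∷ tail x)
head-split (true  ∷ x) = true  , cong (true ∷_) (sym (+-identityˡ x))
head-split (false ∷ x) = false , cong (false ∷_) (sym (+-identityˡ x))

additive-closed : {m : ℕ} {f : Bits n → Bits m} → (∀ u v → f (u + v) ≡ f u + f v) → Closed (λ v → f v ≡ 𝟎)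
additive-closed {f = f} f-+ = record
  { 𝟎-closed = trans (cong f (sym (+-self 𝟎))) (trans (f-+ 𝟎 𝟎) (+-self (f 𝟎)))
  ; +-closed = λ p q → trans (f-+ _ _) (trans (cong₂ _+_ p q) (+-self 𝟎))
  }

independent⇒≢𝟎 : ∀ {a : Bits n} {bs : Vec (Bits n) k} → Independent (a ∷ bs) → a ≢ 𝟎
independent⇒≢𝟎 {bs = bs} ind refl = independent-∷⁻ ind (𝟎-closed (span-closed bs))

-- The planes above the line ⟨a, b⟩ are indexed by the nonzero vectors of K/⟨a, b⟩.  Division by a
-- identifies this quotient with K/⟨1, b/a⟩.

module Line {a b : K} (independent : Independent (a ∷ b ∷ []))
            (a⁻¹ : K) (a⁻¹a≡𝟏 : a⁻¹ * a ≡ 𝟏) where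

  open ≡-Reasoning

  z : Bits 7
  z = tail (a⁻¹ * b)

  key : K → Bits 6
  key v = quot z (tail (a⁻¹ * v))

  representative : Bits 6 → K
  representative y = a * (false ∷ section z y)

  a[a⁻¹v]≡v : ∀ v → a * (a⁻¹ * v) ≡ v
  a[a⁻¹v]≡v = cancelˡ a a⁻¹ (trans (*-comm a a⁻¹) a⁻¹a≡𝟏)

  a∈ : a ∈⟨ a ∷ b ∷ [] ⟩
  a∈ = generator (a ∷ b ∷ []) zero

  b∈ : b ∈⟨ a ∷ b ∷ [] ⟩
  b∈ = generator (a ∷ b ∷ []) (suc zero)

  a* : ∀ p → a * (p · 𝟏) ≡ p · a
  a* true  = *-identityʳ a
  a* false = horner-zeroʳ a

  ·-* : ∀ p v → a * (p · v) ≡ p · (a * v)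
  ·-* true  v = refl
  ·-* false v = horner-zeroʳ a

  key-+ : ∀ u v → key (u + v) ≡ key u + key v
  key-+ u v = trans (cong (quot z ∘ tail) (horner-+ʳ a⁻¹ u v))
    (trans (cong (quot z) (tail-+ (a⁻¹ * u) (a⁻¹ * v))) (quot-+ z _ _))

  key-line : ∀ {v} → v ∈⟨ a ∷ b ∷ [] ⟩ → key v ≡ 𝟎
  key-line = ⟨⟩-closed {P = λ v → key v ≡ 𝟎} (additive-closed key-+)
    ( trans (cong (quot z ∘ tail) a⁻¹a≡𝟏) (𝟎-closed (additive-closed (quot-+ z)))
    ∷ quot-self z
    ∷ [])

  z′ : K
  z′ = false ∷ z

  b-split : ∃[ h ] b ≡ h · a + a * z′
  b-split = let h , eq = head-split (a⁻¹ * b) in h , (begin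
    b                        ≡⟨ a[a⁻¹v]≡v b ⟨
    a * (a⁻¹ * b)            ≡⟨ cong (a *_) eq ⟩
    a * (h · 𝟏 + z′)         ≡⟨ horner-+ʳ a (h · 𝟏) z′ ⟩
    a * (h · 𝟏) + a * z′     ≡⟨ cong (_+ a * z′) (a* h) ⟩
    h · a + a * z′           ∎)

  az′∈ : a * z′ ∈⟨ a ∷ b ∷ [] ⟩
  az′∈ = let h , eq = b-split in
    subst (_∈⟨ a ∷ b ∷ [] ⟩) (trans (cong (h · a +_) eq) (x+[x+y]≡y (h · a) (a * z′)))
      (+-closed closed (·-closed closed h a∈) b∈)
    where closed = span-closed (a ∷ b ∷ [])

  -- Otherwise b/a would lie in F₂, against the independence of `a` and `b`.
  z≢𝟎 : z ≢ 𝟎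
  z≢𝟎 z≡𝟎 = let h , eq = b-split in contradiction (independent (h ∷ true ∷ []) (begin
    h · a + (b + 𝟎)             ≡⟨ cong (h · a +_) (+-identityʳ b) ⟩
    h · a + b                   ≡⟨ cong (h · a +_) eq ⟩
    h · a + (h · a + a * z′)    ≡⟨ x+[x+y]≡y (h · a) (a * z′) ⟩
    a * (false ∷ z)             ≡⟨ cong (λ t → a * (false ∷ t)) z≡𝟎 ⟩
    a * 𝟎                       ≡⟨ horner-zeroʳ a ⟩
    𝟎                           ∎)) λ ()

  line-member : ∀ v p → tail (a⁻¹ * v) ≡ p · z → v ∈⟨ a ∷ b ∷ [] ⟩
  line-member v p eq = let q , split = head-split (a⁻¹ * v) in
    subst (_∈⟨ a ∷ b ∷ [] ⟩) (sym (begin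
      v                                        ≡⟨ a[a⁻¹v]≡v v ⟨
      a * (a⁻¹ * v)                            ≡⟨ cong (a *_) split ⟩
      a * (q · 𝟏 + (false ∷ tail (a⁻¹ * v)))   ≡⟨ cong (λ t → a * (q · 𝟏 + t)) (trans (cong (false ∷_) eq) (false∷· p)) ⟩
      a * (q · 𝟏 + p · z′)                     ≡⟨ horner-+ʳ a (q · 𝟏) (p · z′) ⟩
      a * (q · 𝟏) + a * (p · z′)               ≡⟨ cong₂ _+_ (a* q) (·-* p z′) ⟩
      q · a + p · (a * z′)                     ∎))
      (+-closed closed (·-closed closed q a∈) (·-closed closed p az′∈))
    where
    closed = span-closed (a ∷ b ∷ [])
    false∷· : ∀ p → false ∷ p · z ≡ p · z′
    false∷· true  = refl
    false∷· false = refl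

  key-kernel : ∀ v → key v ≡ 𝟎 → v ∈⟨ a ∷ b ∷ [] ⟩
  key-kernel v eq = let p , eq′ = quot-kernel z z≢𝟎 (tail (a⁻¹ * v)) eq in line-member v p eq′

  key-representative : ∀ y → key (representative y) ≡ y
  key-representative y = trans (cong (quot z ∘ tail) (cancelˡ a⁻¹ a a⁻¹a≡𝟏 (false ∷ section z y))) (quot-section z y)

  key-injective : ∀ {v w} → key v ≡ key w → v ∈⟨ w ∷ a ∷ b ∷ [] ⟩
  key-injective {v} {w} eq = subst (_∈⟨ w ∷ a ∷ b ∷ [] ⟩)
    (trans (cong (w +_) (+-comm v w)) (x+[x+y]≡y w v))
    (+-closed (span-closed _) (generator (w ∷ a ∷ b ∷ []) zero)
      (∈⟨∷⟩ (key-kernel (v + w) (trans (key-+ v w) (trans (cong (_+ key w) eq) (+-self (key w)))))))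

  key-plane : ∀ {v w} → v ∈⟨ w ∷ a ∷ b ∷ [] ⟩ → ¬ v ∈⟨ a ∷ b ∷ [] ⟩ → key v ≡ key w
  key-plane {w = w} (true  ∷ c , refl) v∉ =
    trans (key-+ w (lin c _)) (trans (cong (key w +_) (key-line (c , refl))) (+-identityʳ (key w)))
  key-plane         (false ∷ c , refl) v∉ = contradiction (c , +-identityˡ (lin c _)) v∉

  exchange : ∀ {v w x} → v ∈⟨ w ∷ a ∷ b ∷ [] ⟩ → x ∈⟨ v ∷ a ∷ b ∷ [] ⟩ → x ∈⟨ w ∷ a ∷ b ∷ [] ⟩
  exchange v∈ = ⟨⟩-closed (span-closed _) (v∈ ∷ ∈⟨∷⟩ a∈ ∷ ∈⟨∷⟩ b∈ ∷ [])

  Above : Fin 3 → Bits 6 → Set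
  Above i y = colour (representative y) a b ≡ ω^ i

  above? : ∀ i → Decidable (Above i)
  above? i y = colour (representative y) a b ≟ ω^ i

  above : Fin 3 → List (Bits 6)
  above i = filter (above? i) (combinations 6)

  -- The plane with index `y` above ⟨a, b⟩ is `a` times the plane with the same index above ⟨1, z′⟩.
  -- The point is that `j` does not depend on `y`.
  representative-colour : ∃[ j ] ∀ y →
    colour (representative y) a b ≡ ω^ j * colour (false ∷ section z y) 𝟏 z′
  representative-colour with degree a
  ... | inj₁ a≡𝟎 = contradiction a≡𝟎 (independent⇒≢𝟎 independent)
  ... | inj₂ (eq , j , χ≡) = j , λ y → let v = false ∷ section z y in begin
    colour (a * v) a b                        ≡⟨ colour-basis (in₁ v) (in₂ v) ⟩
    colour (a * v) (a * 𝟏) (a * z′)           ≡⟨ colour-* a v 𝟏 z′ eq ⟩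
    χ (norm₁₂ a) * colour v 𝟏 z′              ≡⟨ cong (_* colour v 𝟏 z′) χ≡ ⟩
    ω^ j * colour v 𝟏 z′                      ∎
    where
    B₁ B₂ : K → Vec K 3
    B₁ v = a * v ∷ a * 𝟏 ∷ a * z′ ∷ []
    B₂ v = a * v ∷ a ∷ b ∷ []
    in₁ : ∀ v → All (_∈⟨ B₁ v ⟩) (B₂ v)
    in₁ v =
      let h , b≡ = b-split
          closed = span-closed (B₁ v)
          a∈′ = subst (_∈⟨ B₁ v ⟩) (*-identityʳ a) (generator (B₁ v) (suc zero))
          b∈′ = subst (_∈⟨ B₁ v ⟩) (sym b≡)
                  (+-closed closed (·-closed closed h a∈′) (generator (B₁ v) (suc (suc zero))))
      in generator (B₁ v) zero ∷ a∈′ ∷ b∈′ ∷ []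
    in₂ : ∀ v → All (_∈⟨ B₂ v ⟩) (B₁ v)
    in₂ v = generator (B₂ v) zero ∷ subst (_∈⟨ B₂ v ⟩) (sym (*-identityʳ a)) (∈⟨∷⟩ a∈) ∷ ∈⟨∷⟩ az′∈ ∷ []

  -- Scaling permutes the colours, so colour `i` above ⟨a, b⟩ occurs as often as the colour `l` with
  -- `ω^ j * ω^ l ≡ ω^ i` above ⟨1, z′⟩.
  length-above : ∀ i → length (above i) ≡ 21
  length-above i =
    let j , colour≡ = representative-colour
        l , ω≡ = ω^-divides j i
    in trans (cong length (List.filter-≐ (above? i) (λ y → colour (false ∷ section z y) 𝟏 z′ ≟ ω^ l)
         ( (λ {y} p → ω^-cancelˡ j (trans (sym (colour≡ y)) (trans p (sym ω≡))))
         , (λ {y} p → trans (colour≡ y) (trans (cong (ω^ j *_) p) ω≡)))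
         (combinations 6)))
       (balanced z z≢𝟎 l)

-- Counting a setoid by a list.

∈-combinations : (v : Bits n) → v ∈ combinations n
∈-combinations []          = here refl
∈-combinations (false ∷ v) = ∈-++⁺ˡ (∈-map⁺ (false ∷_) (∈-combinations v))
∈-combinations (true  ∷ v) = ∈-++⁺ʳ _ (∈-map⁺ (true ∷_) (∈-combinations v))

combinations-unique : ∀ n → Unique (combinations n)
combinations-unique zero    = ListAll.[] ∷ []
combinations-unique (suc n) = Unique.++⁺
  (Unique.map⁺ (cong tail) (combinations-unique n))
  (Unique.map⁺ (cong tail) (combinations-unique n))
  disjoint
  where
  disjoint : ∀ {v} → ¬ (v ∈ List.map (false ∷_) (combinations n) × v ∈ List.map (true ∷_) (combinations n))
  disjoint (p , q) with ∈-map⁻ (false ∷_) p | ∈-map⁻ (true ∷_) q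
  ... | _ , _ , refl | _ , _ , ()

lookup-injective : ∀ {a} {A : Set a} {xs : List A} → Unique xs → ∀ i j → List.lookup xs i ≡ List.lookup xs j → i ≡ j
lookup-injective (x∉ ∷ u) zero    zero    eq = refl
lookup-injective (x∉ ∷ u) zero    (suc j) eq = contradiction eq (ListAll.lookup x∉ (∈-lookup j))
lookup-injective (x∉ ∷ u) (suc i) zero    eq = contradiction (sym eq) (ListAll.lookup x∉ (∈-lookup i))
lookup-injective (x∉ ∷ u) (suc i) (suc j) eq = cong suc (lookup-injective u i j eq)

-- Subspaces are predicates and cannot be listed directly. They are counted through a complete
-- invariant `f` whose values form a list without repetitions.
enumeration : ∀ {a ℓ} (S : Setoid a ℓ) (let open Setoid S) {A : Set} (f : Carrier → A) →
  (∀ s t → s ≈ t → f s ≡ f t) → (∀ s t → f s ≡ f t → s ≈ t) →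
  ∀ {xs} → Unique xs → (∀ s → f s ∈ xs) → (∀ {x} → x ∈ xs → ∃[ s ] f s ≡ x) →
  HasCardinality S (length xs)
enumeration S f f-cong f-injective {xs} unique f∈ preimage = record
  { to = to
  ; from = from
  ; to-cong = λ {s} {t} s≈t → to-unique (trans (lookup-to s) (trans (f-cong s t s≈t) (sym (lookup-to t))))
  ; from-cong = λ { refl → refl′ }
  ; inverse =
      (λ {i} {s} s≈ → to-unique (trans (lookup-to s) (trans (f-cong s (from i) s≈) (f-from i))))
    , (λ { {s} refl → f-injective (from (to s)) s (trans (f-from (to s)) (lookup-to s)) })
  }
  where
  open Setoid S using (Carrier) renaming (refl to refl′)
  to : Carrier → Fin (length xs)
  to s = Any.index (f∈ s)
  from : Fin (length xs) → Carrier
  from i = proj₁ (preimage (∈-lookup i))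
  f-from : ∀ i → f (from i) ≡ List.lookup xs i
  f-from i = proj₂ (preimage (∈-lookup i))
  lookup-to : ∀ s → List.lookup xs (to s) ≡ f s
  lookup-to s = sym (Any.lookup-index (f∈ s))
  to-unique : ∀ {i j} → List.lookup xs i ≡ List.lookup xs j → i ≡ j
  to-unique = lookup-injective unique _ _

-- The field F₂ and subspaces of F₂⁸ in coordinates.

F₂-heytingField : HeytingField 0ℓ 0ℓ 0ℓ
F₂-heytingField = record
  { Carrier = Bool
  ; _≈_ = _≡_
  ; _#_ = _≢_
  ; _+_ = _xor_
  ; _*_ = _∧_
  ; -_ = λ b → b
  ; 0# = false
  ; 1# = true
  ; isHeytingField = record
    { isHeytingCommutativeRing = record
      { isCommutativeRing = CommutativeRing.isCommutativeRing Bool.xor-∧-commutativeRing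
      ; isApartnessRelation = record
        { irrefl = λ p≡q p≢q → p≢q p≡q
        ; sym = λ p≢q q≡p → p≢q (sym q≡p)
        ; cotrans = λ {p} {q} p≢q r → cotrans p≢q (p Bool.≟ r)
        }
      ; #⇒invertible = λ {p} {q} p≢q → true , difference p q p≢q , trans (Bool.∧-identityʳ _) (difference p q p≢q)
      ; invertible⇒# = λ { {p} (r , _ , eq) refl → contradiction (trans (sym (cong (_∧ r) (Bool.xor-same p))) eq) λ () }
      }
    ; tight = λ p q → Bool-stable p q , λ p≡q p≢q → p≢q p≡q
    }
  }
  where
  cotrans : ∀ {p q r} → p ≢ q → Dec (p ≡ r) → p ≢ r ⊎ r ≢ q
  cotrans p≢q (yes refl) = inj₂ p≢q
  cotrans p≢q (no p≢r)   = inj₁ p≢r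
  difference : ∀ p q → p ≢ q → p xor q ≡ true
  difference true  true  p≢q = contradiction refl p≢q
  difference true  false p≢q = refl
  difference false true  p≢q = refl
  difference false false p≢q = contradiction refl p≢q
  Bool-stable : ∀ p q → ¬ p ≢ q → p ≡ q
  Bool-stable p q = decidable-stable (p Bool.≟ q)

F₂ : FiniteField 2
F₂ = record
  { heytingField = F₂-heytingField
  ; cardinality  = inverse Fin.2↔Bool
  }

open Designs F₂ 8

V : Set
V = Vector Bool 8

tabulate-⊕ : ∀ {n} (u v : Fin n → Bool) → tabulate (λ i → u i xor v i) ≡ tabulate u + tabulate v
tabulate-⊕ {zero}  u v = refl
tabulate-⊕ {suc n} u v = cong ((u zero xor v zero) ∷_) (tabulate-⊕ (u ∘ suc) (v ∘ suc))

tabulate-false : ∀ {n} → tabulate {n = n} (λ _ → false) ≡ 𝟎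
tabulate-false {zero}  = refl
tabulate-false {suc n} = cong (false ∷_) tabulate-false

tabulate-∧ : ∀ {n} c (v : Fin n → Bool) → tabulate (λ i → c ∧ v i) ≡ c · tabulate v
tabulate-∧ true  v = refl
tabulate-∧ false v = tabulate-false

tabulate-injective : ∀ {n} {u v : Fin n → Bool} → tabulate u ≡ tabulate v → ∀ i → u i ≡ v i
tabulate-injective {u = u} {v} eq i =
  trans (sym (lookup∘tabulate u i)) (trans (cong (λ t → lookup t i) eq) (lookup∘tabulate v i))

-- Vectors of `V` are functions compared pointwise. Tabulating them turns this into propositional
-- equality, on which the arithmetic of `K` rests.
coordinates : ∀ {k} → Vector V k → Vec K k
coordinates b = tabulate (tabulate ∘ b)

tabulate-linearCombination : ∀ {k} (c : Fin k → Bool) (b : Vector V k) →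
  tabulate (linearCombination c b) ≡ lin (tabulate c) (coordinates b)
tabulate-linearCombination {zero}  c b = refl
tabulate-linearCombination {suc k} c b = trans
  (tabulate-⊕ (λ i → c zero ∧ b zero i) (linearCombination (c ∘ suc) (b ∘ suc)))
  (cong₂ _+_ (tabulate-∧ (c zero) (b zero)) (tabulate-linearCombination (c ∘ suc) (b ∘ suc)))

lookup-linearCombination : ∀ {k} (c : Bits k) (b : Vector V k) →
  tabulate (linearCombination (lookup c) b) ≡ lin c (coordinates b)
lookup-linearCombination c b =
  trans (tabulate-linearCombination (lookup c) b) (cong (λ d → lin d (coordinates b)) (tabulate∘lookup c))

coordinates-independent : ∀ {k} (b : Vector V k) → LinearlyIndependent b → Independent (coordinates b)
coordinates-independent b ind c eq = trans (sym (tabulate∘lookup c)) (trans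
  (tabulate-cong (ind (lookup c)
    (tabulate-injective (trans (lookup-linearCombination c b) (trans eq (sym tabulate-false))))))
  tabulate-false)

member-coordinates : ∀ {k} {U : Subspace} {b : Vector V k} → IsBasis U b →
  ∀ {v} → member U v → tabulate v ∈⟨ coordinates b ⟩
member-coordinates {b = b} isBasis v∈ =
  let c , v≈ = IsBasis.spanning isBasis v∈
  in tabulate c , trans (tabulate-cong v≈) (tabulate-linearCombination c b)

linearCombination-closed : ∀ (U : Subspace) {k} (c : Fin k → Bool) {b : Vector V k} →
  (∀ i → member U (b i)) → member U (linearCombination c b)
linearCombination-closed U {zero}  c b∈ = Subspace.0ᴹ-closed U
linearCombination-closed U {suc k} c b∈ = Subspace.+ᴹ-closed U (Subspace.*ₗ-closed U (c zero) (b∈ zero))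
  (linearCombination-closed U (c ∘ suc) (b∈ ∘ suc))

coordinates-member : ∀ {k} {U : Subspace} {b : Vector V k} → IsBasis U b →
  ∀ {v} → tabulate v ∈⟨ coordinates b ⟩ → member U v
coordinates-member {U = U} {b} isBasis {v} (c , eq) = Subspace.∈-resp-≈ᴹ U
  (tabulate-injective (trans (lookup-linearCombination c b) (sym eq)))
  (linearCombination-closed U (lookup c) (IsBasis.contained isBasis))

spanOf : ∀ {k} → Vec K k → Subspace
spanOf bs = record
  { member    = λ v → tabulate v ∈⟨ bs ⟩
  ; ∈-resp-≈ᴹ = λ u≈v → subst (_∈⟨ bs ⟩) (tabulate-cong u≈v)
  ; 0ᴹ-closed = subst (_∈⟨ bs ⟩) (sym tabulate-false) (𝟎-closed closed)
  ; +ᴹ-closed = λ {u} {v} u∈ v∈ → subst (_∈⟨ bs ⟩) (sym (tabulate-⊕ u v)) (+-closed closed u∈ v∈)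
  ; *ₗ-closed = λ c {v} v∈ → subst (_∈⟨ bs ⟩) (sym (tabulate-∧ c v)) (·-closed closed c v∈)
  }
  where closed = span-closed bs

vectors : ∀ {k} → Vec K k → Vector V k
vectors bs i = lookup (lookup bs i)

coordinates-vectors : ∀ {k} (bs : Vec K k) → coordinates (vectors bs) ≡ bs
coordinates-vectors bs = trans (tabulate-cong (λ i → tabulate∘lookup (lookup bs i))) (tabulate∘lookup bs)

spanOf-basis : ∀ {k} (bs : Vec K k) → Independent bs → IsBasis (spanOf bs) (vectors bs)
spanOf-basis bs ind = record
  { contained   = λ i → subst (_∈⟨ bs ⟩) (sym (tabulate∘lookup (lookup bs i))) (generator bs i)
  ; independent = λ c eq → tabulate-injective (trans
      (ind (tabulate c) (trans (sym (combination c)) (trans (tabulate-cong eq) tabulate-false)))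
      (sym tabulate-false))
  ; spanning    = λ { (c , eq) → lookup c , tabulate-injective (trans eq (trans
                      (cong (λ d → lin d bs) (sym (tabulate∘lookup c))) (sym (combination (lookup c))))) }
  }
  where
  combination : ∀ c → tabulate (linearCombination c (vectors bs)) ≡ lin (tabulate c) bs
  combination c = trans (tabulate-linearCombination c (vectors bs)) (cong (lin (tabulate c)) (coordinates-vectors bs))

⊆-coordinates : ∀ {k l} {U W : Subspace} {b : Vector V k} {c : Vector V l} → IsBasis U b → IsBasis W c →
  member U ⊆ member W → All (_∈⟨ coordinates c ⟩) (coordinates b)
⊆-coordinates isBasisᵁ isBasisᵂ U⊆W = tabulate⁺ λ i → member-coordinates isBasisᵂ (U⊆W (IsBasis.contained isBasisᵁ i))

-- The colour classes as designs.

colourᵛ : Vec K 3 → K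
colourᵛ (c ∷ a ∷ b ∷ []) = colour c a b

colourᵛ-basis : (B C : Vec K 3) → All (_∈⟨ B ⟩) C → All (_∈⟨ C ⟩) B → colourᵛ C ≡ colourᵛ B
colourᵛ-basis (_ ∷ _ ∷ _ ∷ []) (_ ∷ _ ∷ _ ∷ []) = colour-basis

planeColour : 3 -Subspace → K
planeColour (_ , b , _) = colourᵛ (coordinates b)

planeColour-cong : ∀ {U W} → Setoid._≈_ (subspaces 3) U W → planeColour U ≡ planeColour W
planeColour-cong {_ , b , isBasisᵁ} {_ , c , isBasisᵂ} (U⊆W , W⊆U) =
  colourᵛ-basis (coordinates c) (coordinates b) (⊆-coordinates isBasisᵁ isBasisᵂ U⊆W) (⊆-coordinates isBasisᵂ isBasisᵁ W⊆U)

planeColour-value : ∀ U → ∃[ i ] planeColour U ≡ ω^ i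
planeColour-value (_ , b , isBasis) = colour-value (coordinates-independent b (IsBasis.independent isBasis))

Coloured : Fin 3 → 3 -Subspace → Set
Coloured i U = planeColour U ≡ ω^ i

module AboveLine (T : 2 -Subspace) (i : Fin 3) where
  τ : Vector V 2
  τ = proj₁ (proj₂ T)

  isBasisᵀ : IsBasis (proj₁ T) τ
  isBasisᵀ = proj₂ (proj₂ T)

  a b : K
  a = tabulate (τ zero)
  b = tabulate (τ (suc zero))

  independent : Independent (a ∷ b ∷ [])
  independent = coordinates-independent τ (IsBasis.independent isBasisᵀ)

  a-inverse : ∃[ a⁻¹ ] a⁻¹ * a ≡ 𝟏
  a-inverse with invertible a
  ... | inj₁ a≡𝟎     = contradiction a≡𝟎 (independent⇒≢𝟎 independent)
  ... | inj₂ inverse = inverse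

  open Line independent (proj₁ a-inverse) (proj₂ a-inverse)

  S : Setoid _ _
  S = Restrict (subspaces 3) (Coloured i ∩ (T ⊑_))

  open Setoid S using (Carrier; _≈_)

  basis : Carrier → Vec K 3
  basis ((_ , β , _) , _) = coordinates β

  extension : ∀ s → ∃[ w ] w ∈⟨ basis s ⟩ × Independent (w ∷ a ∷ b ∷ []) ×
    (∀ {v} → v ∈⟨ basis s ⟩ → v ∈⟨ w ∷ a ∷ b ∷ [] ⟩)
  extension ((_ , β , isBasisᵁ) , _ , T⊆U) with ⊆-coordinates isBasisᵀ isBasisᵁ T⊆U
  ... | a∈U ∷ b∈U ∷ [] =
    basis-extension (coordinates-independent β (IsBasis.independent isBasisᵁ)) a∈U b∈U independent

  point : Carrier → K
  point s = proj₁ (extension s)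

  point∉ : ∀ s → ¬ point s ∈⟨ a ∷ b ∷ [] ⟩
  point∉ s = independent-∷⁻ (proj₁ (proj₂ (proj₂ (extension s))))

  to-plane : ∀ s {v} → v ∈⟨ basis s ⟩ → v ∈⟨ point s ∷ a ∷ b ∷ [] ⟩
  to-plane s = proj₂ (proj₂ (proj₂ (extension s)))

  generators : ∀ s → All (_∈⟨ basis s ⟩) (point s ∷ a ∷ b ∷ [])
  generators s@((_ , _ , isBasisᵁ) , _ , T⊆U) = proj₁ (proj₂ (extension s)) ∷ ⊆-coordinates isBasisᵀ isBasisᵁ T⊆U

  from-plane : ∀ s {v} → v ∈⟨ point s ∷ a ∷ b ∷ [] ⟩ → v ∈⟨ basis s ⟩
  from-plane s = ⟨⟩-closed (span-closed (basis s)) (generators s)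

  -- A plane above the line is a single nonzero vector of the quotient, so every choice of `point`
  -- off the line gives the same key.
  index : Carrier → Bits 6
  index s = key (point s)

  index-cong : ∀ s t → s ≈ t → index s ≡ index t
  index-cong s@((_ , _ , isBasisᵁ) , _) t@((_ , _ , isBasisᵂ) , _) (U⊆W , _) = key-plane
    (to-plane t (⟨⟩-closed (span-closed (basis t)) (⊆-coordinates isBasisᵁ isBasisᵂ U⊆W) (proj₁ (proj₂ (extension s)))))
    (point∉ s)

  index-injective : ∀ s t → index s ≡ index t → s ≈ t
  index-injective s t eq = included s t eq , included t s (sym eq)
    where
    included : ∀ s t → index s ≡ index t → member (proj₁ (proj₁ s)) ⊆ member (proj₁ (proj₁ t))
    included s@((_ , _ , isBasisᵁ) , _) t@((_ , _ , isBasisᵂ) , _) eq v∈ = coordinates-member isBasisᵂ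
      (from-plane t (exchange (key-injective eq) (to-plane s (member-coordinates isBasisᵁ v∈))))

  -- `point s` and the representative of its key differ by a vector of the line, so both span the
  -- given plane together with `a` and `b`, and the colour is the same.
  index-above : ∀ s → index s ∈ above i
  index-above s@((_ , β , _) , coloured , _) = ∈-filter⁺ (above? i) (∈-combinations (index s)) (trans
    (colourᵛ-basis (basis s) (r ∷ a ∷ b ∷ [])
      (from-plane s (key-injective (key-representative (index s))) ∷ generators′)
      (tabulate⁺ λ j → exchange (key-injective (sym (key-representative (index s))))
        (to-plane s (subst (_∈⟨ basis s ⟩) (lookup∘tabulate (tabulate ∘ β) j) (generator (basis s) j)))))
    coloured)
    where
    r = representative (index s)
    generators′ : All (_∈⟨ basis s ⟩) (a ∷ b ∷ [])
    generators′ with _ ∷ gs ← generators s = gs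

  preimage : ∀ {y} → y ∈ above i → ∃[ s ] index s ≡ y
  preimage {y} y∈ = s , trans (key-plane point∈ (point∉ s)) (key-representative y)
    where
    coloured : colour (representative y) a b ≡ ω^ i
    coloured = proj₂ (∈-filter⁻ (above? i) {xs = combinations 6} y∈)

    B : Vec K 3
    B = representative y ∷ a ∷ b ∷ []

    -- A representative on the line would have the colour `𝟎`, which is no cube root of unity. This
    -- is how the index `𝟎` is excluded.
    independent-B : Independent B
    independent-B = independent-∷⁺
      (λ r∈ → ω^≢𝟎 i (trans (sym coloured) (colour-degenerate r∈))) independent

    s : Carrier
    s = (spanOf B , vectors B , spanOf-basis B independent-B)
      , trans (cong colourᵛ (coordinates-vectors B)) coloured
      , λ v∈ → ∈⟨∷⟩ (member-coordinates isBasisᵀ v∈)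

    point∈ : point s ∈⟨ B ⟩
    point∈ = subst (λ C → point s ∈⟨ C ⟩) (coordinates-vectors B) (proj₁ (proj₂ (extension s)))

  cardinality : HasCardinality S 21
  cardinality = subst (HasCardinality S) (length-above i)
    (enumeration S index index-cong index-injective
      (Unique.filter⁺ (above? i) (combinations-unique 6)) index-above preimage)

colourClass : Fin 3 → Design 2 3 21
colourClass i = record
  { blocks     = Coloured i
  ; respects   = λ {U} {W} U≈W coloured → trans (sym (planeColour-cong {U} {W} U≈W)) coloured
  ; isBalanced = λ T → AboveLine.cardinality T i
  }

colourClasses : LargeSet 3 2 3 21
colourClasses = record
  { design   = colourClass
  ; disjoint = λ {i} {j} i≢j (colouredⁱ , colouredʲ) → i≢j (ω^-injective i j (trans (sym colouredⁱ) colouredʲ))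
  ; covers   = planeColour-value
  }

theorem1 : ∃[ q ] ∃[ n ] ∃[ k ] ∃[ t ] ∃[ λ′ ] ∃[ N ]
    (IsPrimePower q × 2 ≤ t × t < k × k < n × 1 ≤ λ′ × 2 ≤ N ×
    Σ[ F ∈ FiniteField q ] Designs.LargeSet F n N t k λ′)
theorem1 = 2 , 8 , 3 , 2 , 21 , 3
  , (2 , 1 , prime[2] , ℕ.≤-refl , refl)
  , ℕ.≤-refl , ℕ.≤-refl , ℕ.m≤m+n 4 4 , ℕ.m≤m+n 1 20 , ℕ.m≤m+n 2 1
  , F₂ , colourClasses
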